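{- The following is provable in $\mathrm{BZFC}$: for each cardinal number $\kappa$, there are uniquely determined classical cardinals $\kappa_{\mathbf t}$, $\kappa_{\mathbf b}$, and $\kappa_{\mathbf n}$ such that $$\kappa=\kappa_{\mathbf t}+\kappa_{\mathbf b}\cdot\mathfrak b+\kappa_{\mathbf n}\cdot\mathfrak n.$$
   Context: Logic. The background logic is the four-valued first-order logic BS4 with primitives $\sim,\land,\lor,\rightarrow,\leftrightarrow,\bot,\forall,\exists$. A model has a non-empty domain $M$, the usual interpretations of constants and function symbols, and, for each $n$-ary relation symbol $R$, two independent interpretations $R^+,R^-\subseteq M^n$; $=^+$ is true identity and $=^-$ is a symmetric relation. Truth and falsity are defined simultaneously (a formula may be true, false, both, or neither): an atomic formula is true/false according to $R^+$/$R^-$; $\sim\varphi$ is true iff $\varphi$ is false, and false iff $\varphi$ is true; $\varphi\land\psi$ is true iff both are true, false iff at least one is false; $\lor$ dually; $\varphi\rightarrow\psi$ is true iff ($\varphi$ true implies $\psi$ true), false iff $\varphi$ is true and $\psi$ is false; $\varphi\leftrightarrow\psi$ is true iff ($\varphi$ true iff $\psi$ true), false iff ($\varphi$ true and $\psi$ false) or ($\varphi$ false and $\psi$ true); $\forall$ is true iff all instances are true, false iff some instance is false; $\exists$ is true iff some instance is true, false iff all instances are false; $\bot$ is false and not true. $\Gamma\vDash\varphi$ iff $\varphi$ is true in every model in which all of $\Gamma$ is true. Asserting a formula means asserting that it is true; English "iff", "if/then", "and", "or" between formulas concern truth. Abbreviations: $\neg\varphi:=\varphi\rightarrow\bot$ (true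 iff $\varphi$ is not true); $!\varphi:=\sim\neg\varphi$ (two-valued, true iff $\varphi$ is true); $?\varphi:=\neg\sim\varphi$ (two-valued, true iff $\varphi$ is not false); $\circ\varphi:=\,!\varphi\leftrightarrow ?\varphi$; $\varphi\Rightarrow\psi:=(\varphi\rightarrow\psi)\land(\sim\psi\rightarrow\sim\varphi)$; $\varphi\Leftrightarrow\psi:=(\varphi\leftrightarrow\psi)\land(\sim\varphi\leftrightarrow\sim\psi)$; $\varphi\,\&\,\psi:=\,\sim(\varphi\rightarrow\sim\psi)$; $\exists x\in A\,\varphi:=\exists x(x\in A\,\&\,\varphi)$; $\forall x\in A\,\varphi:=\forall x(x\in A\rightarrow\varphi)$. A slashed relation symbol is the $\sim$-negation of the relation. Set theory. $\mathrm{BZFC}$ is a BS4-theory in the language $\{\in,=\}$ whose objects are called sets. It includes: Extensionality $\forall A\forall B(A=B\Leftrightarrow\forall x(x\in A\Leftrightarrow x\in B))$; Comprehension $\forall A\exists B\forall x(x\in B\Leftrightarrow x\in A\land\varphi(x))$; ACLA: $\exists A(A^!\not\subseteq A^?)\land\exists A(A^?\not\subseteq A^!)$; Choice: every classical set of non-empty sets has a choice function. Here $A=\{x:\varphi(x)\}$ means $\forall x(x\in A\Leftrightarrow\varphi(x))$; $A\subseteq B:=\forall x(x\in A\Rightarrow x\in B)$; $A$ is classical if $\forall x\,{\circ}(x\in A)$; $A^!:=\{x:{!}(x\in A)\}$ and $A^?:=\{x:{?}(x\in A)\}$. The remaining axioms are suitable analogues of those of $\mathrm{ZFC}$; available consequences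 are: $A^!,A^?$ are (classical) sets; $A\subseteq B\leftrightarrow(A^!\subseteq B^!\land A^?\subseteq B^?)$, $A\not\subseteq B\leftrightarrow A^!\not\subseteq B^?$, $A=B\leftrightarrow(A^!=B^!\land A^?=B^?)$, $A\neq B\leftrightarrow(A^!\not\subseteq B^?\lor B^!\not\subseteq A^?)$; for all classical sets $X,Y$ there is a unique set $\langle X|Y\rangle$ with $\langle X|Y\rangle^!=X$, $\langle X|Y\rangle^?=Y$; ordered pairs (and triples) are encoded so that $(a,b)=(c,d)\Leftrightarrow(a=c\land b=d)$; usual $\mathrm{ZFC}$ set theory (including choice and von Neumann ordinals, which live in the inner $\mathrm{ZFC}$-model of hereditarily classical sets) applies to classical sets, whose elements may be arbitrary sets. For a classical set $X$, $|X|_{Cl}$ is the least von Neumann ordinal in bijection with $X$. Put $A_{\mathbf b}:=A^!\setminus A^?$, $A_{\mathbf t}:=A^!\cap A^?$, $A_{\mathbf n}:=A^?\setminus A^!$, $\mathrm{rlm}(A):=A^!\cup A^?$ (all classical sets). For pairwise disjoint classical $X,Y,Z$, $\langle X|Y|Z\rangle$ is the unique set $A$ with $A_{\mathbf b}=X$, $A_{\mathbf t}=Y$, $A_{\mathbf n}=Z$. $\emptyset=\{x:\bot\}$, and $\{a\}$ is the classical set $\{x:{!}(x=a)\}$. Cardinal numbers. The cardinal number of $A$ is the triple $|A|:=(X,Y,Z)$ with $$X:=\big\langle |A^!|_{Cl}\,\big|\,|A^?|_{Cl}\big\rangle,\quad Y:=\big\langle |A_{\mathbf t}|_{Cl}\,\big|\,|A^?|_{Cl}\big\rangle,\quad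 Z:=\big\langle |A_{\mathbf b}|_{Cl}\,\big|\,|A_{\mathbf n}|_{Cl}\big\rangle.$$ Cardinal numbers are the elements of $\{|x|:x\text{ a set}\}$. A classical cardinal is a cardinal number of the form $|X|$ with $X$ a classical set. Arithmetic: $|A|+|B|:=|A\uplus B|$ and $|A|\cdot|B|:=|A\times B|$, where $A\times B:=\{(x,y):x\in A\land y\in B\}$ (so $(a,b)\in A\times B\Leftrightarrow a\in A\land b\in B$) and $A\uplus B:=\{(x,0):x\in A\}\cup\{(x,1):x\in B\}$ (so $(a,0)\in A\uplus B\Leftrightarrow a\in A$ and $(b,1)\in A\uplus B\Leftrightarrow b\in B$). Finally $\mathfrak b:=|\langle\{\emptyset\}|\emptyset|\emptyset\rangle|$ and $\mathfrak n:=|\langle\emptyset|\emptyset|\{\emptyset\}\rangle|$. -}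

module Defs where

open import Level using (Level) renaming (suc to lsuc)
open import Data.Nat using (ℕ; zero; suc; _+_)
open import Data.Fin using (Fin; zero; suc) renaming (_↑ʳ_ to infixr 9 _↑ʳ_)
open import Data.Vec using (Vec; []; _∷_; lookup)
import Data.Vec.Functional as F
open import Data.Product using (∃; _×_)
open import Data.Sum using (_⊎_)
open import Data.Empty.Polymorphic using (⊥)
open import Data.Unit.Polymorphic using (⊤)
open import Relation.Binary.PropositionalEquality using (_≡_)

-- BS4 formulas over {∈, =}, with free variables among n de Bruijn indices; `∀̇` and `∃̇`
-- bind index 0.

infix  8 _∈̇_ _≐_
infixr 7 ∼_ ∀̇_ ∃̇_
infixr 6 _∧_
infixr 5 _∨_
infixr 4 _⟶_ _⟷_

data Formula : ℕ → Set where
  _∈̇_ _≐_          : ∀ {n} → Fin n → Fin n → Formula n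
  ⊥̇                : ∀ {n} → Formula n
  ∼_               : ∀ {n} → Formula n → Formula n
  _∧_ _∨_ _⟶_ _⟷_  : ∀ {n} → Formula n → Formula n → Formula n
  ∀̇_ ∃̇_            : ∀ {n} → Formula (suc n) → Formula n

-- =⁺ is true identity, so only =⁻ is part of the data.

record Model (ℓ : Level) : Set (lsuc ℓ) where
  field
    Carrier : Set ℓ
    point   : Carrier
    _∈⁺_    : Carrier → Carrier → Set ℓ
    _∈⁻_    : Carrier → Carrier → Set ℓ
    _=⁻_    : Carrier → Carrier → Set ℓ
    =⁻-sym  : ∀ {x y} → x =⁻ y → y =⁻ x

module _ {ℓ : Level} (𝔐 : Model ℓ) where
  open Model 𝔐

  True False : ∀ {n} → Vec Carrier n → Formula n → Set ℓ

  True ρ (x ∈̇ y)  = lookup ρ x ∈⁺ lookup ρ y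
  True ρ (x ≐ y)  = lookup ρ x ≡ lookup ρ y
  True ρ ⊥̇        = ⊥
  True ρ (∼ φ)    = False ρ φ
  True ρ (φ ∧ ψ)  = True ρ φ × True ρ ψ
  True ρ (φ ∨ ψ)  = True ρ φ ⊎ True ρ ψ
  True ρ (φ ⟶ ψ)  = True ρ φ → True ρ ψ
  True ρ (φ ⟷ ψ)  = (True ρ φ → True ρ ψ) × (True ρ ψ → True ρ φ)
  True ρ (∀̇ φ)    = ∀ a → True (a ∷ ρ) φ
  True ρ (∃̇ φ)    = ∃ λ a → True (a ∷ ρ) φ

  False ρ (x ∈̇ y) = lookup ρ x ∈⁻ lookup ρ y
  False ρ (x ≐ y) = lookup ρ x =⁻ lookup ρ y
  False ρ ⊥̇       = ⊤
  False ρ (∼ φ)   = True ρ φ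
  False ρ (φ ∧ ψ) = False ρ φ ⊎ False ρ ψ
  False ρ (φ ∨ ψ) = False ρ φ × False ρ ψ
  False ρ (φ ⟶ ψ) = True ρ φ × False ρ ψ
  False ρ (φ ⟷ ψ) = (True ρ φ × False ρ ψ) ⊎ (False ρ φ × True ρ ψ)
  False ρ (∀̇ φ)   = ∃ λ a → False (a ∷ ρ) φ
  False ρ (∃̇ φ)   = ∀ a → False (a ∷ ρ) φ

Sentence : Set
Sentence = Formula 0

Theory : Set₁
Theory = Sentence → Set

-- The metatheory of BS4 is classical: under ExcludedMiddle ℓ the clauses
-- above are the usual two-valued conditions on truth and on falsity.

_⊨[_]_ : Theory → (ℓ : Level) → Sentence → Set (lsuc ℓ)
T ⊨[ ℓ ] φ = (𝔐 : Model ℓ) → (∀ {ψ} → T ψ → True 𝔐 [] ψ) → True 𝔐 [] φ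

rename : ∀ {m n} → (Fin m → Fin n) → Formula m → Formula n
rename f (x ∈̇ y) = f x ∈̇ f y
rename f (x ≐ y) = f x ≐ f y
rename f ⊥̇       = ⊥̇
rename f (∼ φ)   = ∼ rename f φ
rename f (φ ∧ ψ) = rename f φ ∧ rename f ψ
rename f (φ ∨ ψ) = rename f φ ∨ rename f ψ
rename f (φ ⟶ ψ) = rename f φ ⟶ rename f ψ
rename f (φ ⟷ ψ) = rename f φ ⟷ rename f ψ
rename f (∀̇ φ)   = ∀̇ rename (zero F.∷ λ i → suc (f i)) φ
rename f (∃̇ φ)   = ∃̇ rename (zero F.∷ λ i → suc (f i)) φ

∀* : ∀ {n} → Formula n → Sentence
∀* {zero}  φ = φ
∀* {suc n} φ = ∀* (∀̇ φ)

infixr 7 ¬̇_ !_ ¿_ ∘_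
infixr 6 _&_
infixr 4 _⇒_ _⇔_

¬̇_ !_ ¿_ ∘_ : ∀ {n} → Formula n → Formula n
¬̇ φ = φ ⟶ ⊥̇
! φ = ∼ ¬̇ φ
¿ φ = ¬̇ ∼ φ
∘ φ = ! φ ⟷ ¿ φ

_⇒_ _⇔_ _&_ : ∀ {n} → Formula n → Formula n → Formula n
φ ⇒ ψ = (φ ⟶ ψ) ∧ (∼ ψ ⟶ ∼ φ)
φ ⇔ ψ = (φ ⟷ ψ) ∧ (∼ φ ⟷ ∼ ψ)
φ & ψ = ∼ (φ ⟶ ∼ ψ)

∀∈ ∃∈ : ∀ {n} → Fin n → Formula (suc n) → Formula n
∀∈ A φ = ∀̇ (zero ∈̇ suc A ⟶ φ)
∃∈ A φ = ∃̇ (zero ∈̇ suc A & φ)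

-- From here on, a defined term t(x,…) is represented by a
-- formula expressing "y = t(x,…)", with y as first argument.  Under k
-- additional binders an outer variable x becomes k ↑ʳ x.

private variable n : ℕ

pattern v₀ = zero
pattern v₁ = suc v₀
pattern v₂ = suc v₁
pattern v₃ = suc v₂
pattern v₄ = suc v₃
pattern v₅ = suc v₄
pattern v₆ = suc v₅
pattern v₇ = suc v₆

-- A = {x : φ(x)}
_≔_ : Fin n → Formula (suc n) → Formula n
A ≔ φ = ∀̇ (v₀ ∈̇ suc A ⇔ φ)

_⊆̇_ : Fin n → Fin n → Formula n
A ⊆̇ B = ∀̇ (v₀ ∈̇ suc A ⇒ v₀ ∈̇ suc B)

Classical : Fin n → Formula n
Classical A = ∀̇ ∘ (v₀ ∈̇ suc A)

Empty : Fin n → Formula n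
Empty e = e ≔ ⊥̇

-- s = {a}
Singleton : (s a : Fin n) → Formula n
Singleton s a = s ≔ (! (v₀ ≐ suc a))

-- X = A^!, A^?, A_b, A_t, A_n respectively
Bang Query PartB PartT PartN : (X A : Fin n) → Formula n
Bang  X A = X ≔ (! (v₀ ∈̇ suc A))
Query X A = X ≔ (¿ (v₀ ∈̇ suc A))
PartB X A = X ≔ (! (v₀ ∈̇ suc A) ∧ ∼ ¿ (v₀ ∈̇ suc A))
PartT X A = X ≔ (! (v₀ ∈̇ suc A) ∧ ¿ (v₀ ∈̇ suc A))
PartN X A = X ≔ (¿ (v₀ ∈̇ suc A) ∧ ∼ ! (v₀ ∈̇ suc A))

-- A = ⟨X|Y⟩ and A = ⟨X|Y|Z⟩
Angle₂ : (A X Y : Fin n) → Formula n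
Angle₂ A X Y = Bang X A ∧ Query Y A

Angle₃ : (A X Y Z : Fin n) → Formula n
Angle₃ A X Y Z = PartB X A ∧ PartT Y A ∧ PartN Z A

-- Kuratowski pairs satisfy only the truth half of
-- (a,b) = (c,d) ⇔ (a = c ∧ b = d), because the equality of classical
-- singletons is two-valued.  Both halves hold for
--   (a,b) := {⟨{x}|∅⟩ : x ∈ a} ∪ {⟨∅|{x}⟩ : x ∈ b},
-- the disjoint union of a and b with respect to two injective tagging
-- operations with disjoint ranges.  The conditions z = tag(x) occur to the
-- left of & so that only their truth matters.

TagL TagR : (z x : Fin n) → Formula n
TagL z x = ∃̇ ∃̇ (Singleton v₁ (2 ↑ʳ x) ∧ Empty v₀ ∧ Angle₂ (2 ↑ʳ z) v₁ v₀)
TagR z x = ∃̇ ∃̇ (Singleton v₁ (2 ↑ʳ x) ∧ Empty v₀ ∧ Angle₂ (2 ↑ʳ z) v₀ v₁)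

-- p = (a,b)
Pair : (p a b : Fin n) → Formula n
Pair p a b = p ≔ (∃̇ (TagL v₁ v₀ & v₀ ∈̇ 2 ↑ʳ a)
                 ∨ ∃̇ (TagR v₁ v₀ & v₀ ∈̇ 2 ↑ʳ b))

-- t = (a,b,c) = (a,(b,c))
Triple : (t a b c : Fin n) → Formula n
Triple t a b c = ∃̇ (Pair v₀ (suc b) (suc c) ∧ Pair (suc t) (suc a) v₀)

-- (a,b) ∈ f
PairIn : (a b f : Fin n) → Formula n
PairIn a b f = ∃̇ (Pair v₀ (suc a) (suc b) ∧ v₀ ∈̇ suc f)

-- P = A × B = {(x,y) : x ∈ A ∧ y ∈ B}; here & makes (a,b) ∈ A × B
-- equivalent to a ∈ A ∧ b ∈ B also with respect to falsity.
Product : (P A B : Fin n) → Formula n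
Product P A B =
  P ≔ (∃̇ ∃̇ (Pair v₂ v₁ v₀ & (v₁ ∈̇ 3 ↑ʳ A ∧ v₀ ∈̇ 3 ↑ʳ B)))

-- t = (x,0) and t = (x,1)
PairZero PairOne : (t x : Fin n) → Formula n
PairZero t x = ∃̇ (Empty v₀ ∧ Pair (suc t) (suc x) v₀)
PairOne  t x = ∃̇ ∃̇ (Empty v₁ ∧ Singleton v₀ v₁ ∧ Pair (2 ↑ʳ t) (2 ↑ʳ x) v₀)

-- S = A ⊎ B
DisjointUnion : (S A B : Fin n) → Formula n
DisjointUnion S A B = S ≔ (∃̇ (PairZero v₁ v₀ & v₀ ∈̇ 2 ↑ʳ A)
                          ∨ ∃̇ (PairOne  v₁ v₀ & v₀ ∈̇ 2 ↑ʳ B))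

-- f is a classical function with domain X
Function : (f X : Fin n) → Formula n
Function f X =
    Classical f
  ∧ ∀∈ f (∃∈ (suc X) (∃̇ Pair v₂ v₁ v₀))
  ∧ ∀∈ X (∃̇ (PairIn v₁ v₀ (2 ↑ʳ f)
             ∧ ∀̇ (PairIn v₂ v₀ (3 ↑ʳ f) ⟶ v₀ ≐ v₁)))

Bijection : (f X Y : Fin n) → Formula n
Bijection f X Y =
    Function f X
  ∧ ∀̇ ∀̇ (PairIn v₁ v₀ (2 ↑ʳ f) ⟶ v₀ ∈̇ 2 ↑ʳ Y)
  ∧ ∀̇ ∀̇ ∀̇ (PairIn v₂ v₀ (3 ↑ʳ f) ∧ PairIn v₁ v₀ (3 ↑ʳ f) ⟶ v₂ ≐ v₁)
  ∧ ∀∈ Y (∃̇ PairIn v₀ v₁ (2 ↑ʳ f))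

Equinumerous : (X Y : Fin n) → Formula n
Equinumerous X Y = ∃̇ Bijection v₀ (suc X) (suc Y)

-- A transitive set of classical sets that is itself classical is
-- hereditarily classical, so this is "von Neumann ordinal of the inner
-- ZFC-model": transitive and strictly well-ordered by ∈.
Ordinal : Fin n → Formula n
Ordinal α =
    Classical α
  ∧ ∀∈ α (Classical v₀)
  ∧ ∀∈ α (v₀ ⊆̇ suc α)
  ∧ ∀∈ α (¬̇ v₀ ∈̇ v₀)
  ∧ ∀∈ α (∀∈ (suc α) (∀∈ (2 ↑ʳ α) (v₂ ∈̇ v₁ ∧ v₁ ∈̇ v₀ ⟶ v₂ ∈̇ v₀)))
  ∧ ∀∈ α (∀∈ (suc α) (v₁ ∈̇ v₀ ∨ v₁ ≐ v₀ ∨ v₀ ∈̇ v₁))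
  ∧ ∀̇ (Classical v₀ ∧ v₀ ⊆̇ suc α ∧ ∃̇ v₀ ∈̇ v₁
        ⟶ ∃∈ v₀ (∀∈ v₁ (v₁ ≐ v₀ ∨ v₁ ∈̇ v₀)))

-- c = |X|_Cl, for X classical
ClCard : (c X : Fin n) → Formula n
ClCard c X =
    Ordinal c
  ∧ Equinumerous X c
  ∧ ∀̇ (Ordinal v₀ ∧ Equinumerous (suc X) v₀ ⟶ suc c ≐ v₀ ∨ suc c ∈̇ v₀)

-- c = |A^!|_Cl, |A^?|_Cl, |A_b|_Cl, |A_t|_Cl, |A_n|_Cl respectively
CardBang CardQuery CardB CardT CardN : (c A : Fin n) → Formula n
CardBang  c A = ∃̇ (Bang  v₀ (suc A) ∧ ClCard (suc c) v₀)
CardQuery c A = ∃̇ (Query v₀ (suc A) ∧ ClCard (suc c) v₀)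
CardB     c A = ∃̇ (PartB v₀ (suc A) ∧ ClCard (suc c) v₀)
CardT     c A = ∃̇ (PartT v₀ (suc A) ∧ ClCard (suc c) v₀)
CardN     c A = ∃̇ (PartN v₀ (suc A) ∧ ClCard (suc c) v₀)

-- k = |A|
Card : (k A : Fin n) → Formula n
Card k A =
  ∃̇ ∃̇ ∃̇ ∃̇ ∃̇
    (CardBang v₄ (5 ↑ʳ A) ∧ CardQuery v₃ (5 ↑ʳ A) ∧ CardT v₂ (5 ↑ʳ A)
    ∧ CardB v₁ (5 ↑ʳ A) ∧ CardN v₀ (5 ↑ʳ A)
    ∧ ∃̇ ∃̇ ∃̇ (Angle₂ v₂ v₇ v₆ ∧ Angle₂ v₁ v₅ v₆ ∧ Angle₂ v₀ v₄ v₃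
              ∧ Triple (8 ↑ʳ k) v₂ v₁ v₀))

CardinalNumber ClassicalCardinal : Fin n → Formula n
CardinalNumber    k = ∃̇ Card (suc k) v₀
ClassicalCardinal k = ∃̇ (Classical v₀ ∧ Card (suc k) v₀)

-- m = k + l and m = k · l
SumOf ProductOf : (m k l : Fin n) → Formula n
SumOf m k l =
  ∃̇ ∃̇ ∃̇ (Card (3 ↑ʳ k) v₂ ∧ Card (3 ↑ʳ l) v₁
          ∧ DisjointUnion v₀ v₂ v₁ ∧ Card (3 ↑ʳ m) v₀)
ProductOf m k l =
  ∃̇ ∃̇ ∃̇ (Card (3 ↑ʳ k) v₂ ∧ Card (3 ↑ʳ l) v₁
          ∧ Product v₀ v₂ v₁ ∧ Card (3 ↑ʳ m) v₀)

-- k = 𝔟 = |⟨{∅}|∅|∅⟩| and k = 𝔫 = |⟨∅|∅|{∅}⟩|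
Is𝔟 Is𝔫 : Fin n → Formula n
Is𝔟 k = ∃̇ ∃̇ ∃̇ (Empty v₂ ∧ Singleton v₁ v₂ ∧ Angle₃ v₀ v₁ v₂ v₂
                ∧ Card (3 ↑ʳ k) v₀)
Is𝔫 k = ∃̇ ∃̇ ∃̇ (Empty v₂ ∧ Singleton v₁ v₂ ∧ Angle₃ v₀ v₂ v₂ v₁
                ∧ Card (3 ↑ʳ k) v₀)

-- k = t + b · 𝔟 + m · 𝔫, bracketed to the left
Decomposition : (k t b m : Fin n) → Formula n
Decomposition k t b m =
  ∃̇ ∃̇ ∃̇ ∃̇ ∃̇
    (Is𝔟 v₄ ∧ Is𝔫 v₃
    ∧ ProductOf v₂ (5 ↑ʳ b) v₄
    ∧ ProductOf v₁ (5 ↑ʳ m) v₃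
    ∧ SumOf v₀ (5 ↑ʳ t) v₂
    ∧ SumOf (5 ↑ʳ k) v₀ v₁)

ClassicalDecomposition : (k t b m : Fin n) → Formula n
ClassicalDecomposition k t b m =
    ClassicalCardinal t ∧ ClassicalCardinal b ∧ ClassicalCardinal m
  ∧ Decomposition k t b m

UniqueDecomposition : Sentence
UniqueDecomposition =
  ∀̇ (CardinalNumber v₀ ⟶
    ∃̇ ∃̇ ∃̇ (ClassicalDecomposition v₃ v₂ v₁ v₀ ∧
      ∀̇ ∀̇ ∀̇ (ClassicalDecomposition v₆ v₂ v₁ v₀ ⟶
               v₂ ≐ v₅ ∧ v₁ ≐ v₄ ∧ v₀ ≐ v₃)))

extensionality classicalSuperset pairing union powerSet infinity
  foundation choice acla : Sentence

extensionality =
  ∀̇ ∀̇ (v₁ ≐ v₀ ⇔ ∀̇ (v₀ ∈̇ v₂ ⇔ v₀ ∈̇ v₁))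

-- φ has the free variables x, parameters
comprehension : Formula (suc n) → Sentence
comprehension φ =
  ∀* (∀̇ ∃̇ ∀̇ (v₀ ∈̇ v₁ ⇔ v₀ ∈̇ v₂ ∧ rename (v₀ F.∷ (3 ↑ʳ_)) φ))

-- Since x ∈ {x ∈ C : φ} is false for x outside C, Comprehension yields
-- A^! and A^? only inside a classical set containing both.
classicalSuperset = ∀̇ ∃̇ (Classical v₀ ∧ v₁ ⊆̇ v₀)

pairing = ∀̇ ∀̇ ∃̇ (v₀ ≔ (! (v₀ ≐ v₃) ∨ ! (v₀ ≐ v₂)))

union = ∀̇ ∃̇ (v₀ ≔ ∃∈ v₂ (v₁ ∈̇ v₀))

-- The ! is needed: A ⊈ X is not true of any A with A^! ⊆ X^?, whatever
-- A^? is, so {A : A ⊆ X} is not a set.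
powerSet = ∀̇ ∃̇ (v₀ ≔ (! (v₀ ⊆̇ v₂)))

infinity =
  ∃̇ (∃∈ v₀ (Empty v₀)
    ∧ ∀∈ v₀ (∃∈ v₁ (v₀ ≔ (v₀ ∈̇ v₂ ∨ ! (v₀ ≐ v₂)))))

-- φ has the free variables x, y, parameters
replacement : Formula (2 + n) → Sentence
replacement φ =
  ∀* (∀̇ (∀∈ v₀ (∀̇ ∀̇ (rename (v₂ F.∷ v₁ F.∷ (4 ↑ʳ_)) φ
                       ∧ rename (v₂ F.∷ v₀ F.∷ (4 ↑ʳ_)) φ ⟶ v₁ ≐ v₀))
         ⟶ ∃̇ (v₀ ≔ ∃∈ v₂ (! rename (v₀ F.∷ v₁ F.∷ (4 ↑ʳ_)) φ))))

-- Every A with an element has an element x such that no element of A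
-- lies in rlm(x) = x^! ∪ x^?.
foundation =
  ∀̇ (∃̇ v₀ ∈̇ v₁ ⟶ ∃∈ v₀ (¬̇ ∃∈ v₁ (! (v₀ ∈̇ v₁) ∨ ¿ (v₀ ∈̇ v₁))))

choice =
  ∀̇ (Classical v₀ ∧ ∀∈ v₀ (∃̇ v₀ ∈̇ v₁)
    ⟶ ∃̇ (Function v₀ v₁ ∧ ∀∈ v₁ (∀̇ (PairIn v₁ v₀ v₂ ⟶ v₀ ∈̇ v₁))))

acla =
    ∃̇ ∃̇ ∃̇ (Bang v₁ v₂ ∧ Query v₀ v₂ ∧ ∼ (v₁ ⊆̇ v₀))
  ∧ ∃̇ ∃̇ ∃̇ (Bang v₁ v₂ ∧ Query v₀ v₂ ∧ ∼ (v₀ ⊆̇ v₁))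

data BZFC : Theory where
  ext   : BZFC extensionality
  comp  : (φ : Formula (suc n)) → BZFC (comprehension φ)
  super : BZFC classicalSuperset
  pair  : BZFC pairing
  uni   : BZFC union
  pow   : BZFC powerSet
  inf   : BZFC infinity
  repl  : (φ : Formula (2 + n)) → BZFC (replacement φ)
  found : BZFC foundation
  ch    : BZFC choice
  ac    : BZFC acla

{-# OPTIONS --safe #-}

-- The both-, true- and neither-parts A_b, A_t, A_n of A are recovered up to
-- bijection from |A|: pairing is injective and the three ⟨·|·⟩ in |A| determine
-- the ordinals |A_t|, |A_b| and |A_n|.  Conversely bijections between these parts
-- give |A| = |A'|, since A^! = A_b ∪ A_t and A^? = A_t ∪ A_n are disjoint unions.
-- For classical X, Y, Z the set representing |X| + |Y|·𝔟 + |Z|·𝔫 has parts t, b, n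
-- in bijection with X, Y, Z.  So for κ = |A| the cardinals must be |A_t|, |A_b|,
-- |A_n|, and these work.  The well-ordering theorem is never used: every classical
-- set whose ordinal is needed is in bijection with ∅, {∅}, A^!, A^? or a part of A,
-- and for the last three the ordinals come with κ.
module Submission where

open import Level using (Level; lift)
open import Axiom.ExcludedMiddle using (ExcludedMiddle)
open import Data.Nat using (ℕ; zero; suc; _+_)
open import Data.Fin using (Fin; zero; suc) renaming (_↑ʳ_ to infixr 9 _↑ʳ_)
open import Data.Vec using (Vec; []; _∷_; lookup)
import Data.Vec.Functional as F
open import Data.Product using (∃; _×_; _,_; proj₁; proj₂; map₁; map₂)
open import Data.Sum using (_⊎_; inj₁; inj₂) renaming ([_,_]′ to [_,_])
open import Data.Empty.Polymorphic using (⊥; ⊥-elim)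
open import Data.Unit.Polymorphic using (⊤; tt)
open import Function using (_∘_; id)
open import Relation.Nullary using (yes; no)
open import Relation.Binary.PropositionalEquality using (_≡_; refl; sym; trans; subst; subst₂)
open import Defs

-- Comprehension makes membership false outside the ambient set, so a class becomes a set with the
-- intended falsity only if it is bounded wherever its formula is true or fails to be false. This is
-- why every existence proof has a truth side and a falsity side. `acla` supplies one membership
-- that is both true and false and one that is neither; from these come all sets ⟨X|Y⟩, hence the
-- tags inside ordered pairs and the units 𝔟 and 𝔫. The arithmetic stays elementary because the
-- three summands are concentrated in different statuses: `κ_t` in 𝐭, `κ_b`·𝔟 in 𝐛, `κ_n`·𝔫 in 𝐧. In
-- each status at most one summand is non-empty, so two sizes are never added within one status.

private variable
  ℓ : Level
  n m : ℕ

infix 0 _⟺_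

_⟺_ : Set ℓ → Set ℓ → Set ℓ
A ⟺ B = (A → B) × (B → A)

-- The polymorphic `⊥` makes `Not` definitionally the truth of a formula `¬̇ φ`.
Not : Set ℓ → Set ℓ
Not {ℓ} A = A → ⊥ {ℓ}

⟺-refl : {A : Set ℓ} → A ⟺ A
⟺-refl = id , id

⟺-sym : {A B : Set ℓ} → A ⟺ B → B ⟺ A
⟺-sym (f , g) = g , f

⟺-trans : {A B C : Set ℓ} → A ⟺ B → B ⟺ C → A ⟺ C
⟺-trans (f , g) (h , k) = h ∘ f , g ∘ k

⟺-not : {A B : Set ℓ} → A ⟺ B → Not A ⟺ Not B
⟺-not (f , g) = _∘ g , _∘ f

-- Renaming of variables in four-valued formulas

module _ (𝔐 : Model ℓ) where
  open Model 𝔐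

  -- Comprehension and Replacement place `φ` under extra binders by `rename`; this removes them
  -- again. Truth and falsity need a joint induction, since `∼` swaps them and the falsity of an
  -- implication involves the truth of its premise.
  True-rename : (φ : Formula m) {f : Fin m → Fin n} {ρ : Vec Carrier n} {σ : Vec Carrier m} →
    (∀ i → lookup ρ (f i) ≡ lookup σ i) → True 𝔐 ρ (rename f φ) ⟺ True 𝔐 σ φ
  False-rename : (φ : Formula m) {f : Fin m → Fin n} {ρ : Vec Carrier n} {σ : Vec Carrier m} →
    (∀ i → lookup ρ (f i) ≡ lookup σ i) → False 𝔐 ρ (rename f φ) ⟺ False 𝔐 σ φ

  lookup-lift : {f : Fin m → Fin n} {ρ : Vec Carrier n} {σ : Vec Carrier m} →
    (∀ i → lookup ρ (f i) ≡ lookup σ i) → (a : Carrier) →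
    ∀ i → lookup (a ∷ ρ) ((zero F.∷ λ i → suc (f i)) i) ≡ lookup (a ∷ σ) i
  lookup-lift e a zero    = refl
  lookup-lift e a (suc i) = e i

  True-rename (x ∈̇ y) e rewrite e x | e y = ⟺-refl
  True-rename (x ≐ y) e rewrite e x | e y = ⟺-refl
  True-rename ⊥̇ e = ⟺-refl
  True-rename (∼ φ) e = False-rename φ e
  True-rename (φ ∧ ψ) e with True-rename φ e | True-rename ψ e
  ... | f , f′ | g , g′ = (λ (a , b) → f a , g b) , (λ (a , b) → f′ a , g′ b)
  True-rename (φ ∨ ψ) e with True-rename φ e | True-rename ψ e
  ... | f , f′ | g , g′ = [ inj₁ ∘ f , inj₂ ∘ g ] , [ inj₁ ∘ f′ , inj₂ ∘ g′ ]
  True-rename (φ ⟶ ψ) e with True-rename φ e | True-rename ψ e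
  ... | f , f′ | g , g′ = (λ h → g ∘ h ∘ f′) , (λ h → g′ ∘ h ∘ f)
  True-rename (φ ⟷ ψ) e with True-rename φ e | True-rename ψ e
  ... | p@(f , f′) | q@(g , g′) =
    (λ h → ⟺-trans (⟺-sym p) (⟺-trans h q)) , (λ h → ⟺-trans p (⟺-trans h (⟺-sym q)))
  True-rename (∀̇ φ) e =
    (λ h a → proj₁ (True-rename φ (lookup-lift e a)) (h a)) ,
    (λ h a → proj₂ (True-rename φ (lookup-lift e a)) (h a))
  True-rename (∃̇ φ) e =
    (λ (a , h) → a , proj₁ (True-rename φ (lookup-lift e a)) h) ,
    (λ (a , h) → a , proj₂ (True-rename φ (lookup-lift e a)) h)

  False-rename (x ∈̇ y) e rewrite e x | e y = ⟺-refl
  False-rename (x ≐ y) e rewrite e x | e y = ⟺-refl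
  False-rename ⊥̇ e = ⟺-refl
  False-rename (∼ φ) e = True-rename φ e
  False-rename (φ ∧ ψ) e with False-rename φ e | False-rename ψ e
  ... | f , f′ | g , g′ = [ inj₁ ∘ f , inj₂ ∘ g ] , [ inj₁ ∘ f′ , inj₂ ∘ g′ ]
  False-rename (φ ∨ ψ) e with False-rename φ e | False-rename ψ e
  ... | f , f′ | g , g′ = (λ (a , b) → f a , g b) , (λ (a , b) → f′ a , g′ b)
  False-rename (φ ⟶ ψ) e with True-rename φ e | False-rename ψ e
  ... | f , f′ | g , g′ = (λ (a , b) → f a , g b) , (λ (a , b) → f′ a , g′ b)
  False-rename (φ ⟷ ψ) e
    with True-rename φ e | False-rename φ e | True-rename ψ e | False-rename ψ e
  ... | f , f′ | g , g′ | h , h′ | k , k′ =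
    [ (λ (a , b) → inj₁ (f a , k b)) , (λ (a , b) → inj₂ (g a , h b)) ] ,
    [ (λ (a , b) → inj₁ (f′ a , k′ b)) , (λ (a , b) → inj₂ (g′ a , h′ b)) ]
  False-rename (∀̇ φ) e =
    (λ (a , h) → a , proj₁ (False-rename φ (lookup-lift e a)) h) ,
    (λ (a , h) → a , proj₂ (False-rename φ (lookup-lift e a)) h)
  False-rename (∃̇ φ) e =
    (λ h a → proj₁ (False-rename φ (lookup-lift e a)) (h a)) ,
    (λ h a → proj₂ (False-rename φ (lookup-lift e a)) (h a))

  ∀*-elim : (φ : Formula n) → True 𝔐 [] (∀* φ) → (ρ : Vec Carrier n) → True 𝔐 ρ φ
  ∀*-elim φ h []      = h
  ∀*-elim φ h (a ∷ ρ) = ∀*-elim (∀̇ φ) h ρ a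

-- UniqueDecomposition in an arbitrary context.  The proof is carried out for this
-- formula because unfolding the truth of UniqueDecomposition itself mixes the
-- literal 0 and the constructor zero in implicit arguments, which makes the
-- comparison of types infeasible; recast bridges the two on a variable formula.
UniqueDecompositionIn : Formula n
UniqueDecompositionIn =
  ∀̇ (CardinalNumber v₀ ⟶
    ∃̇ ∃̇ ∃̇ (ClassicalDecomposition v₃ v₂ v₁ v₀ ∧
      ∀̇ ∀̇ ∀̇ (ClassicalDecomposition v₆ v₂ v₁ v₀ ⟶
               v₂ ≐ v₅ ∧ v₁ ≐ v₄ ∧ v₀ ≐ v₃)))

UniqueDecompositionIn≡ : UniqueDecompositionIn {0} ≡ UniqueDecomposition
UniqueDecompositionIn≡ = refl

recast : (𝔐 : Model ℓ) {φ ψ : Sentence} → φ ≡ ψ → True 𝔐 {0} [] φ → True 𝔐 [] ψ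
recast 𝔐 refl h = h

-- Sets from bounded classes

module SetTheory (em : ExcludedMiddle ℓ) (𝔐 : Model ℓ)
                 (ax : ∀ {ψ} → BZFC ψ → True 𝔐 [] ψ) where
  open Model 𝔐 renaming (Carrier to M)

  T F : Vec M n → Formula n → Set ℓ
  T = True 𝔐
  F = False 𝔐

  private variable
    a b c d e p q s x y z f A B C S V X Y : M
    P P′ Q Q′ R N : M → Set ℓ

  lem : (A : Set ℓ) → A ⊎ Not A
  lem A with em {A}
  ... | yes a = inj₁ a
  ... | no ¬a = inj₂ (λ a → lift (¬a a))

  dne : {A : Set ℓ} → Not (Not A) → A
  dne {A} h = [ id , ⊥-elim ∘ h ] (lem A)

  -- By unfolding, the truth of `A ≔ φ` is `Is A` applied to the truth and the falsity of `φ`, so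
  -- defined terms can be handled as pairs of predicates.
  Is : M → (M → Set ℓ) → (M → Set ℓ) → Set ℓ
  Is A P N = ∀ x → (x ∈⁺ A ⟺ P x) × (x ∈⁻ A ⟺ N x)

  Cl : M → (M → Set ℓ) → Set ℓ
  Cl A P = Is A P (λ x → Not (P x))

  extensional : (∀ x → (x ∈⁺ A ⟺ x ∈⁺ B) × (x ∈⁻ A ⟺ x ∈⁻ B)) → A ≡ B
  extensional {A} {B} h = proj₂ (proj₁ (ax ext A B)) h

  Is-unique : Is A P N → Is B P N → A ≡ B
  Is-unique h k = extensional λ x →
    ⟺-trans (proj₁ (h x)) (⟺-sym (proj₁ (k x))) ,
    ⟺-trans (proj₂ (h x)) (⟺-sym (proj₂ (k x)))

  Cl-cong : (∀ x → P x ⟺ Q x) → Cl A P → Cl A Q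
  Cl-cong e h x = ⟺-trans (proj₁ (h x)) (e x) , ⟺-trans (proj₂ (h x)) (⟺-not (e x))

  IsClassical : M → Set ℓ
  IsClassical A = T (A ∷ []) (Classical v₀)

  Cl⇒classical : Cl A P → IsClassical A
  Cl⇒classical h x =
    (λ (i , _) j → proj₁ (proj₂ (h x)) j (proj₁ (proj₁ (h x)) i)) ,
    (λ j → proj₂ (proj₁ (h x)) (dne (j ∘ proj₂ (proj₂ (h x)))) , tt)

  classical⇒Cl : IsClassical A → Cl A (_∈⁺ A)
  classical⇒Cl h x =
    ⟺-refl , (λ j i → proj₁ (h x) (i , tt) j) , (λ k → dne λ ¬j → k (proj₁ (proj₂ (h x) ¬j)))

  comprehend : (φ : Formula (suc n)) (ρ : Vec M n) (A : M) →
    ∃ λ B → Is B (λ x → x ∈⁺ A × T (x ∷ ρ) φ) (λ x → x ∈⁻ A ⊎ F (x ∷ ρ) φ)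
  comprehend φ ρ A with ∀*-elim 𝔐 _ (ax (comp φ)) ρ A
  ... | B , h = B , λ x →
    let k = λ { zero → refl ; (suc i) → refl }
        t = True-rename 𝔐 φ {ρ = x ∷ B ∷ A ∷ ρ} {σ = x ∷ ρ} k
        f = False-rename 𝔐 φ {ρ = x ∷ B ∷ A ∷ ρ} {σ = x ∷ ρ} k
    in ⟺-trans (proj₁ (h x)) (map₂ (proj₁ t) , map₂ (proj₂ t)) ,
       ⟺-trans (proj₂ (h x)) ([ inj₁ , inj₂ ∘ proj₁ f ] , [ inj₁ , inj₂ ∘ proj₂ f ])

  Bounded : (M → Set ℓ) → Set ℓ
  Bounded P = ∃ λ C → ∀ x → P x → x ∈⁺ C

  bounded-⊆ : (∀ x → P x → Q x) → Bounded Q → Bounded P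
  bounded-⊆ h (C , k) = C , λ x → k x ∘ h x

  -- In a classical superset `C`, inclusion carries falsity from `C` back to `A`; what is not false
  -- in `A` is therefore not false in `C`, hence true in it.
  realm-bounded : (A : M) → Bounded (λ x → x ∈⁺ A ⊎ Not (x ∈⁻ A))
  realm-bounded A with ax super A
  ... | C , cl , sub = C , λ x →
    [ proj₁ (sub x) , (λ ¬j → proj₁ (proj₂ (cl x) (¬j ∘ proj₂ (sub x)))) ]

  ∈⁺-bounded : (A : M) → Bounded (_∈⁺ A)
  ∈⁺-bounded A = A , λ _ → id

  -- Separating from a classical `C′` adds falsity exactly outside `C′`. There `φ` is already false,
  -- because the bound also covers the objects on which `φ` is not false.
  bounded⇒set : (φ : Formula (suc n)) (ρ : Vec M n) →
    Bounded (λ x → T (x ∷ ρ) φ ⊎ Not (F (x ∷ ρ) φ)) →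
    ∃ λ B → Is B (λ x → T (x ∷ ρ) φ) (λ x → F (x ∷ ρ) φ)
  bounded⇒set φ ρ (C , sub) with ax super C
  ... | C′ , cl , C⊆C′ with comprehend φ ρ C′
  ... | B , h = B , λ x →
    let inC′ = λ k → proj₁ (C⊆C′ x) (sub x k) in
    ⟺-trans (proj₁ (h x)) (proj₂ , λ t → inC′ (inj₁ t) , t) ,
    ⟺-trans (proj₂ (h x))
      ([ (λ j → dne λ ¬f → proj₁ (cl x) (inC′ (inj₂ ¬f) , tt) j) , id ] , inj₂)

  -- Prefixing `!` turns falsity into the complement of truth, so bounding the truth of `φ`
  -- suffices.
  bounded⇒classical : (φ : Formula (suc n)) (ρ : Vec M n) →
    Bounded (λ x → T (x ∷ ρ) φ) → ∃ λ B → Cl B (λ x → T (x ∷ ρ) φ)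
  bounded⇒classical φ ρ bd
    with bounded⇒set (! φ) ρ (bounded-⊆ (λ _ → [ proj₁ , dne ]) bd)
  ... | B , h = B , λ x → ⟺-trans (proj₁ (h x)) (proj₁ , (_, tt)) , proj₂ (h x)

  empty : ∃ λ e → Cl e (λ _ → ⊥)
  empty = bounded⇒classical ⊥̇ [] (point , λ _ → ⊥-elim)

  doubleton : (a b : M) → ∃ λ s → Cl s (λ x → x ≡ a ⊎ x ≡ b)
  doubleton a b with ax pair a b
  ... | s , h = s , λ x →
    ⟺-trans (proj₁ (h x)) ([ inj₁ ∘ proj₁ , inj₂ ∘ proj₁ ] , [ inj₁ ∘ (_, tt) , inj₂ ∘ (_, tt) ]) ,
    ⟺-trans (proj₂ (h x)) ((λ (i , j) → [ i , j ]) , λ k → k ∘ inj₁ , k ∘ inj₂)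

  singleton : (a : M) → ∃ λ s → Cl s (_≡ a)
  singleton a = map₂ (Cl-cong λ _ → [ id , id ] , inj₁) (doubleton a a)

  ⋃-bounded : (A : M) → Bounded (λ y → ∃ λ x → x ∈⁺ A × y ∈⁺ x)
  ⋃-bounded A with ax uni A
  ... | U , h = U , λ y → proj₂ (proj₁ (h y))

  ∪-bounded : Bounded P → Bounded Q → Bounded (λ x → P x ⊎ Q x)
  ∪-bounded (C , h) (D , k) with doubleton C D
  ... | E , d = bounded-⊆
    (λ x → [ (λ i → C , proj₂ (proj₁ (d C)) (inj₁ refl) , h x i)
           , (λ j → D , proj₂ (proj₁ (d D)) (inj₂ refl) , k x j) ])
    (⋃-bounded E)

  image-bounded : (φ : Formula (2 + n)) (ρ : Vec M n) →
    (∀ {x y z} → T (x ∷ y ∷ ρ) φ → T (x ∷ z ∷ ρ) φ → y ≡ z) →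
    Bounded P → Bounded (λ y → ∃ λ x → P x × T (x ∷ y ∷ ρ) φ)
  image-bounded φ ρ functional (C , sub)
    with ∀*-elim 𝔐 _ (ax (repl φ)) ρ C
           (λ x _ y z (i , j) → functional
             (proj₁ (True-rename 𝔐 φ
               (λ { zero → refl ; (suc zero) → refl ; (suc (suc i)) → refl })) i)
             (proj₁ (True-rename 𝔐 φ
               (λ { zero → refl ; (suc zero) → refl ; (suc (suc i)) → refl })) j))
  ... | B , h = B , λ y (x , px , r) → proj₂ (proj₁ (h y)) (x , sub x px ,
         proj₂ (True-rename 𝔐 φ
               (λ { zero → refl ; (suc zero) → refl ; (suc (suc i)) → refl })) r , tt)

  -- Gluts, gaps and the sets ⟨X|Y⟩

  glut : ∃ λ a → ∃ λ A → a ∈⁺ A × a ∈⁻ A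
  glut with proj₁ (ax ac)
  ... | A , A! , A? , bang , query , x , h = x , A ,
    proj₁ (proj₁ (proj₁ (bang x)) (proj₁ h′)) , proj₁ (proj₁ (proj₂ (query x)) (proj₂ h′))
    -- The falsity of an inclusion is a disjunction, one case for each half of `⇒`; both cases say
    -- that `x` is true on the left and false on the right.
    where h′ = [ id , (λ (i , j) → j , i) ] h

  gap : ∃ λ a → ∃ λ A → Not (a ∈⁺ A) × Not (a ∈⁻ A)
  gap with proj₂ (ax ac)
  ... | A , A! , A? , bang , query , x , h = x , A ,
    proj₁ (proj₂ (bang x)) (proj₂ h′) , proj₁ (proj₁ (query x)) (proj₁ h′)
    where h′ = [ id , (λ (i , j) → j , i) ] h

  -- The instance is {x : (x ∈ X ∧ glut) ∨ (x ∈ Y ∧ gap)}: conjunction with a sentence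
  -- that is both true and false leaves only the truth of x ∈ X, conjunction with
  -- one that is neither leaves only the falsity of x ∈ Y.
  angle : (X Y : M) → ∃ λ A → Is A (_∈⁺ X) (λ x → Not (x ∈⁺ Y))
  angle X Y with glut | gap
  ... | a , A , a∈A , a∉A | b , B , ¬b∈B , ¬b∉B
    with bounded⇒set (((! v₀ ∈̇ v₁) ∧ v₃ ∈̇ v₄) ∨ ((! v₀ ∈̇ v₂) ∧ v₅ ∈̇ v₆))
           (X ∷ Y ∷ a ∷ A ∷ b ∷ B ∷ [])
           (bounded-⊆
             (λ x → [ [ (λ ((i , _) , _) → inj₁ i) , (λ (_ , j) → ⊥-elim (¬b∈B j)) ]
                    , (λ k → inj₂ (dne λ j → k (inj₂ a∉A , inj₁ j))) ])
             (∪-bounded (∈⁺-bounded X) (∈⁺-bounded Y)))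
  ... | D , h = D , λ x →
    ⟺-trans (proj₁ (h x))
      ([ proj₁ ∘ proj₁ , (λ (_ , j) → ⊥-elim (¬b∈B j)) ] , λ i → inj₁ ((i , tt) , a∈A)) ,
    ⟺-trans (proj₂ (h x))
      ((λ (_ , k) → [ id , ⊥-elim ∘ ¬b∉B ] k) , λ k → inj₂ a∉A , inj₁ k)

  Is-singleton : Cl s (_≡ a) ⟺ T (s ∷ a ∷ []) (Singleton v₀ v₁)
  Is-singleton =
    (λ h x → ⟺-trans (proj₁ (h x)) ((_, tt) , proj₁) , proj₂ (h x)) ,
    (λ h x → ⟺-trans (proj₁ (h x)) (proj₁ , (_, tt)) , proj₂ (h x))

  Is-empty : Cl e (λ _ → ⊥) ⟺ T (e ∷ []) (Empty v₀)
  Is-empty =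
    (λ h x → proj₁ (h x) , ⟺-trans (proj₂ (h x)) ((λ _ → tt) , λ _ → id)) ,
    (λ h x → proj₁ (h x) , ⟺-trans (proj₂ (h x)) ((λ _ → id) , λ _ → tt))

  Cl-agree : Cl X P → Cl X Q → ∀ x → P x ⟺ Q x
  Cl-agree h k x = ⟺-trans (⟺-sym (proj₁ (h x))) (proj₁ (k x))

  Bang⟺ : T (X ∷ A ∷ []) (Bang v₀ v₁) ⟺ Cl X (_∈⁺ A)
  Bang⟺ =
    (λ h x → ⟺-trans (proj₁ (h x)) (proj₁ , (_, tt)) , proj₂ (h x)) ,
    (λ h x → ⟺-trans (proj₁ (h x)) ((_, tt) , proj₁) , proj₂ (h x))

  Query⟺ : T (X ∷ A ∷ []) (Query v₀ v₁) ⟺ Cl X (λ x → Not (x ∈⁻ A))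
  Query⟺ =
    (λ h x → proj₁ (h x) , ⟺-trans (proj₂ (h x)) ((λ (j , _) k → k j) , λ k → dne k , tt)) ,
    (λ h x → proj₁ (h x) , ⟺-trans (proj₂ (h x)) ((λ k → dne k , tt) , (λ (j , _) k → k j)))

  Angle₂⟺ : Cl X P → Cl Y Q →
    T (A ∷ X ∷ Y ∷ []) (Angle₂ v₀ v₁ v₂) ⟺ Is A P (λ x → Not (Q x))
  Angle₂⟺ {X} {P} {Y} {Q} {A} hX hY =
    (λ (bang , query) x →
      Cl-agree (proj₁ (Bang⟺ {X} {A}) bang) hX x ,
      ⟺-trans (dni , dne) (⟺-not (Cl-agree (proj₁ (Query⟺ {Y} {A}) query) hY x))) ,
    (λ h →
      proj₂ (Bang⟺ {X} {A}) (Cl-cong (λ x → ⟺-sym (proj₁ (h x))) hX) ,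
      proj₂ (Query⟺ {Y} {A})
        (Cl-cong (λ x → ⟺-trans (dni , dne) (⟺-not (⟺-sym (proj₂ (h x))))) hY))
    where
    dni : {B : Set ℓ} → B → Not (Not B)
    dni b k = k b

  -- Tags and ordered pairs

  TagL⟺ : T (z ∷ x ∷ []) (TagL v₀ v₁) ⟺ Is z (_≡ x) (λ _ → Not ⊥)
  TagL⟺ {z} {x} =
    (λ (s , e , hs , he , h) →
      proj₁ (Angle₂⟺ {A = z} (proj₂ Is-singleton hs) (proj₂ Is-empty he)) h) ,
    (λ h → let s , hs = singleton x ; e , he = empty in
      s , e , proj₁ Is-singleton hs , proj₁ Is-empty he , proj₂ (Angle₂⟺ {A = z} hs he) h)

  TagR⟺ : T (z ∷ x ∷ []) (TagR v₀ v₁) ⟺ Is z (λ _ → ⊥) (λ y → Not (y ≡ x))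
  TagR⟺ {z} {x} =
    (λ (s , e , hs , he , h) →
      proj₁ (Angle₂⟺ {A = z} (proj₂ Is-empty he) (proj₂ Is-singleton hs)) h) ,
    (λ h → let s , hs = singleton x ; e , he = empty in
      s , e , proj₁ Is-singleton hs , proj₁ Is-empty he , proj₂ (Angle₂⟺ {A = z} he hs) h)

  IsTagL IsTagR : M → M → Set ℓ
  IsTagL z x = T (z ∷ x ∷ []) (TagL v₀ v₁)
  IsTagR z x = T (z ∷ x ∷ []) (TagR v₀ v₁)

  angle-Cl : Cl X P → Cl Y Q → ∃ λ A → Is A P (λ x → Not (Q x))
  angle-Cl {X} {P} {Y} {Q} hX hY with angle X Y
  ... | A , h = A , λ x →
    ⟺-trans (proj₁ (h x)) (proj₁ (hX x)) ,
    ⟺-trans (proj₂ (h x)) (⟺-not (proj₁ (hY x)))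

  tagL : (x : M) → ∃ λ z → IsTagL z x
  tagL x = map₂ (proj₂ TagL⟺) (angle-Cl (proj₂ (singleton x)) (proj₂ empty))

  tagR : (x : M) → ∃ λ z → IsTagR z x
  tagR x = map₂ (proj₂ TagR⟺) (angle-Cl (proj₂ empty) (proj₂ (singleton x)))

  tagL-unique : IsTagL y x → IsTagL z x → y ≡ z
  tagL-unique h k = Is-unique (proj₁ TagL⟺ h) (proj₁ TagL⟺ k)

  tagR-unique : IsTagR y x → IsTagR z x → y ≡ z
  tagR-unique h k = Is-unique (proj₁ TagR⟺ h) (proj₁ TagR⟺ k)

  tagL-injective : IsTagL z x → IsTagL z y → x ≡ y
  tagL-injective {z} {x} {y} h k =
    proj₁ (proj₁ (proj₁ TagL⟺ k x)) (proj₂ (proj₁ (proj₁ TagL⟺ h x)) refl)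

  -- A right tag has no true members; `x` is recovered as the only object whose membership is not
  -- false.
  tagR-injective : IsTagR z x → IsTagR z y → x ≡ y
  tagR-injective {z} {x} {y} h k =
    dne λ ne → proj₁ (proj₂ (proj₁ TagR⟺ h x)) (proj₂ (proj₂ (proj₁ TagR⟺ k x)) ne) refl

  tagL≢tagR : IsTagL z x → IsTagR z y → ⊥ {ℓ}
  tagL≢tagR {z} {x} {y} h k =
    proj₁ (proj₁ (proj₁ TagR⟺ k x)) (proj₂ (proj₁ (proj₁ TagL⟺ h x)) refl)

  IsPair : M → M → M → Set ℓ
  IsPair p a b = T (p ∷ a ∷ b ∷ []) (Pair v₀ v₁ v₂)

  -- This is the premise of `bounded⇒set` for both ordered pairs and disjoint unions. Where the
  -- defining disjunction is not false, some `x` that is not false in `A` or in `B` is mapped there,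
  -- so the images of whole realms must be bounded.
  ∪-image-bounded : {L R : M → M → Set ℓ} →
    Bounded (λ z → ∃ λ x → (x ∈⁺ A ⊎ Not (x ∈⁻ A)) × L z x) →
    Bounded (λ z → ∃ λ x → (x ∈⁺ B ⊎ Not (x ∈⁻ B)) × R z x) →
    Bounded (λ z → ((∃ λ x → L z x × x ∈⁺ A) ⊎ (∃ λ x → R z x × x ∈⁺ B)) ⊎
                   Not ((∀ x → L z x → x ∈⁻ A) × (∀ x → R z x → x ∈⁻ B)))
  ∪-image-bounded bL bR = bounded-⊆
    (λ z →
      [ [ (λ (x , t , i) → inj₁ (x , inj₁ i , t)) , (λ (x , t , i) → inj₂ (x , inj₁ i , t)) ]
      , (λ k → dne λ neither → k
          ( (λ x t → dne λ ¬i → neither (inj₁ (x , inj₂ ¬i , t)))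
          , (λ x t → dne λ ¬i → neither (inj₂ (x , inj₂ ¬i , t))))) ])
    (∪-bounded bL bR)

  ordered-pair : (a b : M) → ∃ λ p → IsPair p a b
  ordered-pair a b =
    bounded⇒set (∃̇ (TagL v₁ v₀ & v₀ ∈̇ v₂) ∨ ∃̇ (TagR v₁ v₀ & v₀ ∈̇ v₃)) (a ∷ b ∷ [])
      (∪-image-bounded
        (image-bounded (TagL v₁ v₀) [] tagL-unique (realm-bounded a))
        (image-bounded (TagR v₁ v₀) [] tagR-unique (realm-bounded b)))

  pair-unique : IsPair p a b → IsPair q a b → p ≡ q
  pair-unique h k = Is-unique h k

  pair-left : IsPair p a b → IsTagL z x → (z ∈⁺ p ⟺ x ∈⁺ a) × (z ∈⁻ p ⟺ x ∈⁻ a)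
  pair-left {a = a} {z = z} h t =
    ⟺-trans (proj₁ (h z))
      ( [ (λ (y , u , i) → subst (_∈⁺ a) (tagL-injective u t) i)
        , (λ (y , u , _) → ⊥-elim (tagL≢tagR t u)) ]
      , λ i → inj₁ (_ , t , i)) ,
    ⟺-trans (proj₂ (h z))
      ( (λ (k , _) → k _ t)
      , λ j → (λ y u → subst (_∈⁻ a) (tagL-injective t u) j)
            , (λ y u → ⊥-elim (tagL≢tagR t u)))

  pair-right : IsPair p a b → IsTagR z x → (z ∈⁺ p ⟺ x ∈⁺ b) × (z ∈⁻ p ⟺ x ∈⁻ b)
  pair-right {b = b} {z = z} h t =
    ⟺-trans (proj₁ (h z))
      ( [ (λ (y , u , _) → ⊥-elim (tagL≢tagR u t))
        , (λ (y , u , i) → subst (_∈⁺ b) (tagR-injective u t) i) ]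
      , λ i → inj₂ (_ , t , i)) ,
    ⟺-trans (proj₂ (h z))
      ( (λ (_ , k) → k _ t)
      , λ j → (λ y u → ⊥-elim (tagL≢tagR u t))
            , (λ y u → subst (_∈⁻ b) (tagR-injective t u) j))

  -- Both truth and falsity of membership in a component can be read off from `p` at the
  -- corresponding tag; Extensionality then identifies the components.
  pair-injective : IsPair p a b → IsPair p c d → a ≡ c × b ≡ d
  pair-injective h k =
    extensional (λ x → let z , t = tagL x in
      ⟺-trans (⟺-sym (proj₁ (pair-left h t))) (proj₁ (pair-left k t)) ,
      ⟺-trans (⟺-sym (proj₂ (pair-left h t))) (proj₂ (pair-left k t))) ,
    extensional (λ x → let z , t = tagR x in
      ⟺-trans (⟺-sym (proj₁ (pair-right h t))) (proj₁ (pair-right k t)) ,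
      ⟺-trans (⟺-sym (proj₂ (pair-right h t))) (proj₂ (pair-right k t)))

  -- Replacement sends each `x` in `C` to its row of pairs with second coordinate in `D`; the union
  -- of the rows is the bound.
  ×-bounded : Bounded P → Bounded Q → Bounded (λ p → ∃ λ x → ∃ λ y → P x × Q y × IsPair p x y)
  ×-bounded (C , hC) (D , hD)
    with image-bounded (v₁ ≔ ∃∈ v₃ (! Pair v₁ v₂ v₀)) (D ∷ []) (λ h k → Is-unique h k)
           (∈⁺-bounded C)
  ... | E , hE = bounded-⊆
    (λ p (x , y , px , qy , pr) →
      let B , hB = row x in
      B , hE B (x , hC x px , hB) , proj₂ (proj₁ (hB p)) (y , hD y qy , (pr , tt)))
    (⋃-bounded E)
    where
    row : (x : M) → ∃ λ B → T (x ∷ B ∷ D ∷ []) (v₁ ≔ ∃∈ v₃ (! Pair v₁ v₂ v₀))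
    row x = bounded⇒set (∃∈ v₂ (! Pair v₁ v₂ v₀)) (x ∷ D ∷ [])
      (bounded-⊆
        (λ p → [ (λ (y , i , r , _) → y , i , r)
               , (λ k → dne λ no → k λ y i r → no (y , i , r)) ])
        (image-bounded (Pair v₁ v₂ v₀) (x ∷ []) pair-unique (∈⁺-bounded D)))

  -- Bijections represented by sets

  Maps : M → M → M → Set ℓ
  Maps f x y = T (x ∷ y ∷ f ∷ []) (PairIn v₀ v₁ v₂)

  infix 3 _≋_

  -- Only the graph is a set of the model; the two sides are predicates of the metatheory. Thus
  -- parts of sets can be compared and rewritten along equivalences without naming sets for them.
  record _≋_ (P Q : M → Set ℓ) : Set ℓ where
    field
      graph      : M
      classical  : IsClassical graph
      pairs      : p ∈⁺ graph → ∃ λ x → ∃ λ y → IsPair p x y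
      domain     : Maps graph x y → P x
      range      : Maps graph x y → Q y
      total      : P x → ∃ λ y → Maps graph x y
      onto       : Q y → ∃ λ x → Maps graph x y
      functional : Maps graph x y → Maps graph x z → y ≡ z
      injective  : Maps graph x z → Maps graph y z → x ≡ y

  open _≋_

  -- φ must not depend on the variable v₂, which stands for the pair (x , y).
  definable-bijection : (φ : Formula (3 + n)) (ρ : Vec M n) {R : M → M → Set ℓ} →
    (∀ p x y → T (y ∷ x ∷ p ∷ ρ) φ ⟺ R x y) →
    Bounded P → Bounded Q →
    (∀ {x y} → R x y → P x × Q y) →
    (∀ {x} → P x → ∃ λ y → R x y) → (∀ {y} → Q y → ∃ λ x → R x y) →
    (∀ {x y z} → R x y → R x z → y ≡ z) → (∀ {x y z} → R x z → R y z → x ≡ y) → P ≋ Q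
  definable-bijection {P = P} {Q = Q} φ ρ {R} φ⟺R bP bQ dom-ran tot ont fun inj =
    from-graph (bounded⇒classical (∃̇ ∃̇ (Pair v₂ v₁ v₀ ∧ φ)) ρ
      (bounded-⊆
        (λ p (x , y , pr , r) →
          let i , j = dom-ran (proj₁ (φ⟺R p x y) r) in x , y , i , j , pr)
        (×-bounded bP bQ)))
    where
    from-graph : (∃ λ f → Cl f (λ p → T (p ∷ ρ) (∃̇ ∃̇ (Pair v₂ v₁ v₀ ∧ φ)))) → P ≋ Q
    from-graph (f , hf) = record
      { graph      = f
      ; classical  = Cl⇒classical hf
      ; pairs      = λ {p} i → let x , y , pr , _ = proj₁ (proj₁ (hf p)) i in x , y , pr
      ; domain     = proj₁ ∘ dom-ran ∘ ⇒R
      ; range      = proj₂ ∘ dom-ran ∘ ⇒R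
      ; total      = λ i → map₂ R⇒ (tot i)
      ; onto       = λ i → map₂ R⇒ (ont i)
      ; functional = λ h k → fun (⇒R h) (⇒R k)
      ; injective  = λ h k → inj (⇒R h) (⇒R k)
      }
      where
      ⇒R : Maps f x y → R x y
      ⇒R (p , pr , i) =
        let x′ , y′ , pr′ , r = proj₁ (proj₁ (hf p)) i
            x≡x′ , y≡y′ = pair-injective pr pr′
        in subst₂ R (sym x≡x′) (sym y≡y′) (proj₁ (φ⟺R p x′ y′) r)
      R⇒ : R x y → Maps f x y
      R⇒ {x} {y} r = let p , pr = ordered-pair x y in
        p , pr , proj₂ (proj₁ (hf p)) (x , y , pr , proj₂ (φ⟺R p x y) r)

  -- Replacement along the first coordinate of the graph gives the bound. Hence inverses, composites
  -- and unions of bijections can be formed without boundedness hypotheses.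
  domain-bounded : P ≋ Q → Bounded P
  domain-bounded h = bounded-⊆
    (λ x px → let y , p , pr , i = total h px in p , i , y , pr)
    (image-bounded (∃̇ Pair v₁ v₂ v₀) []
      (λ (_ , k) (_ , l) → proj₁ (pair-injective k l)) (∈⁺-bounded (graph h)))

  range-bounded : P ≋ Q → Bounded Q
  range-bounded h = bounded-⊆
    (λ y qy → let x , p , pr , i = onto h qy in p , i , x , pr)
    (image-bounded (∃̇ Pair v₁ v₀ v₂) []
      (λ (_ , k) (_ , l) → proj₂ (pair-injective k l)) (∈⁺-bounded (graph h)))

  ≋-cong : (∀ x → P x ⟺ P′ x) → (∀ x → Q x ⟺ Q′ x) → P ≋ Q → P′ ≋ Q′
  ≋-cong hP hQ h = record
    { graph      = graph h
    ; classical  = classical h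
    ; pairs      = pairs h
    ; domain     = λ k → proj₁ (hP _) (domain h k)
    ; range      = λ k → proj₁ (hQ _) (range h k)
    ; total      = λ i → total h (proj₂ (hP _) i)
    ; onto       = λ i → onto h (proj₂ (hQ _) i)
    ; functional = functional h
    ; injective  = injective h
    }

  ≋-refl : Cl X P → P ≋ P
  ≋-refl {X} hX = ≋-cong (λ x → proj₁ (hX x)) (λ x → proj₁ (hX x))
    (definable-bijection (v₀ ≐ v₁ ∧ v₀ ∈̇ v₃) (X ∷ []) (λ _ _ _ → ⟺-refl)
      (∈⁺-bounded X) (∈⁺-bounded X)
      (λ { (refl , i) → i , i }) (λ i → _ , refl , i) (λ i → _ , refl , i)
      (λ { (refl , _) (refl , _) → refl }) (λ { (refl , _) (refl , _) → refl }))

  ≋-sym : P ≋ Q → Q ≋ P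
  ≋-sym h = definable-bijection (PairIn v₀ v₁ v₃) (graph h ∷ [])
    {R = λ x y → Maps (graph h) y x} (λ _ _ _ → ⟺-refl)
    (range-bounded h) (domain-bounded h)
    (λ k → range h k , domain h k) (onto h) (total h) (injective h) (functional h)

  ≋-trans : P ≋ Q → Q ≋ R → P ≋ R
  ≋-trans h k = definable-bijection (∃̇ (PairIn v₂ v₀ v₄ ∧ PairIn v₀ v₁ v₅))
    (graph h ∷ graph k ∷ [])
    {R = λ x z → ∃ λ y → Maps (graph h) x y × Maps (graph k) y z} (λ _ _ _ → ⟺-refl)
    (domain-bounded h) (range-bounded k)
    (λ (_ , i , j) → domain h i , range k j)
    (λ px → let y , i = total h px ; z , j = total k (range h i) in z , y , i , j)
    (λ rz → let y , j = onto k rz ; x , i = onto h (domain k j) in x , y , i , j)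
    (λ { (_ , i , j) (_ , i′ , j′) → functional k j (subst (λ y → Maps _ y _) (functional h i′ i) j′) })
    (λ { (_ , i , j) (_ , i′ , j′) → injective h i (subst (λ y → Maps _ _ y) (injective k j′ j) i′) })

  ≋-∪ : P ≋ P′ → Q ≋ Q′ → (∀ x → P x → Q x → ⊥ {ℓ}) → (∀ x → P′ x → Q′ x → ⊥ {ℓ}) →
    (λ x → P x ⊎ Q x) ≋ (λ x → P′ x ⊎ Q′ x)
  ≋-∪ h k disjoint disjoint′ = definable-bijection (PairIn v₁ v₀ v₃ ∨ PairIn v₁ v₀ v₄)
    (graph h ∷ graph k ∷ [])
    {R = λ x y → Maps (graph h) x y ⊎ Maps (graph k) x y} (λ _ _ _ → ⟺-refl)
    (∪-bounded (domain-bounded h) (domain-bounded k))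
    (∪-bounded (range-bounded h) (range-bounded k))
    [ (λ i → inj₁ (domain h i) , inj₁ (range h i))
    , (λ i → inj₂ (domain k i) , inj₂ (range k i)) ]
    [ map₂ inj₁ ∘ total h , map₂ inj₂ ∘ total k ]
    [ map₂ inj₁ ∘ onto h , map₂ inj₂ ∘ onto k ]
    (λ { (inj₁ i) (inj₁ j) → functional h i j
       ; (inj₁ i) (inj₂ j) → ⊥-elim (disjoint _ (domain h i) (domain k j))
       ; (inj₂ i) (inj₁ j) → ⊥-elim (disjoint _ (domain h j) (domain k i))
       ; (inj₂ i) (inj₂ j) → functional k i j })
    (λ { (inj₁ i) (inj₁ j) → injective h i j
       ; (inj₁ i) (inj₂ j) → ⊥-elim (disjoint′ _ (range h i) (range k j))
       ; (inj₂ i) (inj₁ j) → ⊥-elim (disjoint′ _ (range h j) (range k i))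
       ; (inj₂ i) (inj₂ j) → injective k i j })

  Tagged : M → (M → Set ℓ) → M → Set ℓ
  Tagged e P p = ∃ λ x → P x × IsPair p x e

  -- Serves for the two copies inside a disjoint union and for multiplication by a one-element part.
  tagged-≋ : Cl X P → (e : M) → P ≋ Tagged e P
  tagged-≋ {X} hX e =
    ≋-cong (λ x → proj₁ (hX x))
      (λ p → map₂ (map₁ (proj₁ (proj₁ (hX _)))) , map₂ (map₁ (proj₂ (proj₁ (hX _)))))
      (definable-bijection (v₁ ∈̇ v₃ ∧ Pair v₀ v₁ v₄) (X ∷ e ∷ [])
        {R = λ x p → x ∈⁺ X × IsPair p x e} (λ _ _ _ → ⟺-refl)
        (∈⁺-bounded X)
        (image-bounded (Pair v₁ v₀ v₂) (e ∷ []) pair-unique (∈⁺-bounded X))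
        (λ (i , pr) → i , _ , i , pr)
        (λ i → map₂ (i ,_) (ordered-pair _ e))
        id
        (λ (_ , h) (_ , k) → pair-unique h k)
        (λ (_ , h) (_ , k) → proj₁ (pair-injective h k)))

  Equinumerous⟺ : Cl X P → Cl Y Q → T (X ∷ Y ∷ []) (Equinumerous v₀ v₁) ⟺ P ≋ Q
  Equinumerous⟺ {X} {P} {Y} {Q} hX hY = to , from
    where
    to : T (X ∷ Y ∷ []) (Equinumerous v₀ v₁) → P ≋ Q
    to (f , (cl , prs , tot) , ran , inj , ont) = record
      { graph      = f
      ; classical  = cl
      ; pairs      = λ i → let x , _ , y , pr = prs _ i in x , y , pr
      ; domain     = λ k → proj₁ (proj₁ (hX _)) (dom k)
      ; range      = λ k → proj₁ (proj₁ (hY _)) (ran _ _ k)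
      ; total      = λ i → let y , k , _ = tot _ (proj₂ (proj₁ (hX _)) i) in y , k
      ; onto       = λ i → ont _ (proj₂ (proj₁ (hY _)) i)
      ; functional = λ h k → let _ , _ , u = tot _ (dom h) in trans (u _ h) (sym (u _ k))
      ; injective  = λ h k → inj _ _ _ (h , k)
      }
      where
      dom : Maps f x y → x ∈⁺ X
      dom (p , pr , i) = let x′ , j , y′ , pr′ = prs p i in
        subst (_∈⁺ X) (sym (proj₁ (pair-injective pr pr′))) j
    from : P ≋ Q → T (X ∷ Y ∷ []) (Equinumerous v₀ v₁)
    from h = graph h ,
      ( classical h
      , (λ p i → let x , y , pr = pairs h i in
           x , proj₂ (proj₁ (hX _)) (domain h (p , pr , i)) , y , pr)
      , (λ x i → let y , k = total h (proj₁ (proj₁ (hX _)) i) in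
           y , k , λ _ k′ → functional h k′ k)) ,
      (λ x y k → proj₂ (proj₁ (hY _)) (range h k)) ,
      (λ _ _ _ (k , k′) → injective h k k′) ,
      (λ y i → onto h (proj₁ (proj₁ (hY _)) i))

  -- Ordinals and classical cardinality

  IsOrdinal : M → Set ℓ
  IsOrdinal c = T (c ∷ []) (Ordinal v₀)

  ordinal-Cl : IsOrdinal c → Cl c (_∈⁺ c)
  ordinal-Cl h = classical⇒Cl (proj₁ h)

  IsCard : M → (M → Set ℓ) → Set ℓ
  IsCard c P = IsOrdinal c × (P ≋ (_∈⁺ c)) × (∀ d → IsOrdinal d → P ≋ (_∈⁺ d) → c ≡ d ⊎ c ∈⁺ d)

  ClCard⟺ : Cl X P → T (c ∷ X ∷ []) (ClCard v₀ v₁) ⟺ IsCard c P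
  ClCard⟺ {X} hX =
    (λ (o , e , least) →
      o , proj₁ (Equinumerous⟺ {X} hX (ordinal-Cl o)) e ,
      λ d od k → least d (od , proj₂ (Equinumerous⟺ {X} hX (ordinal-Cl od)) k)) ,
    (λ (o , e , least) →
      o , proj₂ (Equinumerous⟺ {X} hX (ordinal-Cl o)) e ,
      λ d (od , k) → least d od (proj₁ (Equinumerous⟺ {X} hX (ordinal-Cl od)) k))

  IsCard-≋ : P ≋ Q → IsCard c P → IsCard c Q
  IsCard-≋ h (o , e , least) =
    o , ≋-trans (≋-sym h) e , λ d od k → least d od (≋-trans h k)

  IsCard⇒≋ : IsCard c P → IsCard c Q → P ≋ Q
  IsCard⇒≋ (_ , h , _) (_ , k , _) = ≋-trans h (≋-sym k)

  -- Transitivity gives `c ⊆ d`, so `d ∈ c` would put `d` into itself, against irreflexivity on the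
  -- elements of `d`.
  ordinal-∈-asym : IsOrdinal c → IsOrdinal d → c ∈⁺ d → d ∈⁺ c → ⊥ {ℓ}
  ordinal-∈-asym {c} {d} _ (_ , _ , tr , irr , _) i j =
    irr d d∈d d∈d
    where d∈d = proj₁ (tr c i d) j

  -- Minimality applied in both directions leaves only equality or mutual membership, and asymmetry
  -- excludes the latter.
  IsCard-unique : IsCard c P → IsCard d P → c ≡ d
  IsCard-unique (oc , hc , lc) (od , hd , ld) with lc _ od hd | ld _ oc hc
  ... | inj₁ refl | _         = refl
  ... | inj₂ _    | inj₁ refl = refl
  ... | inj₂ i    | inj₂ j    = ⊥-elim (ordinal-∈-asym oc od i j)

  Empty≋ : (∀ x → Not (P x)) → (∀ x → Not (Q x)) → P ≋ Q
  Empty≋ hP hQ = let e , he = empty in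
    ≋-cong (λ x → ⊥-elim , hP x) (λ x → ⊥-elim , hQ x) (≋-refl he)

  ≋-empty : P ≋ Q → (∀ x → Not (P x)) → ∀ x → Not (Q x)
  ≋-empty h ¬P y qy = ¬P _ (domain h (proj₂ (onto h qy)))

  IsCard-0 : Cl e (λ _ → ⊥) → (∀ x → Not (P x)) → IsCard e P
  IsCard-0 {e} he ¬P =
    ( Cl⇒classical he , (λ _ → abs) , (λ _ → abs) , (λ _ → abs) , (λ _ → abs) , (λ _ → abs)
    , (λ { _ (_ , sub , x , i) → abs (proj₁ (sub x) i) })) ,
    Empty≋ ¬P (λ x → abs) ,
    λ d od h → inj₁ (Is-unique he (Cl-cong (λ x → ≋-empty h ¬P x , ⊥-elim) (ordinal-Cl od)))
    where
    abs : {A : Set ℓ} → x ∈⁺ e → A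
    abs i = ⊥-elim (proj₁ (proj₁ (he _)) i)

  IsCard-1 : Cl e (λ _ → ⊥) → Cl s (_≡ e) → P ≋ (_≡ e) → IsCard s P
  IsCard-1 {e} {s} he hs hP =
    ( Cl⇒classical hs
    , (λ x i → subst IsClassical (sym (to i)) (Cl⇒classical he))
    , (λ x i y → (λ j → abs (subst (y ∈⁺_) (to i) j))
               , (λ _ → subst (y ∈⁻_) (sym (to i)) (proj₂ (proj₂ (he y)) id)))
    , (λ x i j → abs (subst (x ∈⁺_) (to i) j))
    , (λ x i y j z k (l , _) → abs (subst (x ∈⁺_) (to j) l))
    , (λ x i y j → inj₂ (inj₁ (trans (to i) (sym (to j)))))
    , (λ { X (_ , sub , x , i) → x , i , λ y j →
             inj₁ (trans (to (proj₁ (sub x) i)) (sym (to (proj₁ (sub y) j)))) })) ,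
    ≋-cong (λ _ → ⟺-refl) (λ x → ⟺-sym (proj₁ (hs x))) hP ,
    λ d od h → inj₁ (is-least d od (≋-trans (≋-sym hP) h))
    where
    to : x ∈⁺ s → x ≡ e
    to = proj₁ (proj₁ (hs _))
    abs : {A : Set ℓ} → x ∈⁺ e → A
    abs i = ⊥-elim (proj₁ (proj₁ (he _)) i)
    -- A one-element ordinal is {∅}: an element of its sole member `w` lies in `d` by transitivity,
    -- hence is `w`, against irreflexivity. So `w` is empty.
    is-least : ∀ d → IsOrdinal d → (_≡ e) ≋ (_∈⁺ d) → s ≡ d
    is-least d od@(_ , cl , tr , irr , _) h =
      Is-unique hs (Cl-cong (λ x → (λ i → trans (the i) w≡e) , λ { refl → subst (_∈⁺ d) w≡e w∈d })
                            (ordinal-Cl od))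
      where
      w : M
      w = proj₁ (total h refl)
      w∈d : w ∈⁺ d
      w∈d = range h (proj₂ (total h refl))
      the : x ∈⁺ d → x ≡ w
      the i = let y , k = onto h i in
        functional h (subst (λ y → Maps (graph h) y _) (domain h k) k) (proj₂ (total h refl))
      w≡e : w ≡ e
      w≡e = Is-unique
        (Cl-cong (λ x → (λ i → irr w w∈d (subst (_∈⁺ w) (the (proj₁ (tr w w∈d x) i)) i)) , ⊥-elim)
                 (classical⇒Cl (cl w w∈d)))
        he

  -- The three parts of a set

  data Status : Set where
    𝐛 𝐭 𝐧 : Status

  -- `i` stands for truth and `j` for falsity of a membership. The order of the components follows
  -- `PartB`, `PartT` and `PartN`.
  status : Status → Set ℓ → Set ℓ → Set ℓ
  status 𝐛 i j = i × j
  status 𝐭 i j = i × Not j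
  status 𝐧 i j = Not j × Not i

  status-cong : {i i′ j j′ : Set ℓ} → ∀ κ → i ⟺ i′ → j ⟺ j′ → status κ i j ⟺ status κ i′ j′
  status-cong 𝐛 (f , f′) (g , g′) = (λ (i , j) → f i , g j) , (λ (i , j) → f′ i , g′ j)
  status-cong 𝐭 (f , f′) (g , g′) = (λ (i , j) → f i , j ∘ g′) , (λ (i , j) → f′ i , j ∘ g)
  status-cong 𝐧 (f , f′) (g , g′) = (λ (j , i) → j ∘ g′ , i ∘ f′) , (λ (j , i) → j ∘ g , i ∘ f)

  -- Falsity alone is the fourth status, outside all three parts. Sums and products use this to
  -- reject elements that are not pairs of the required form.
  status-false : {i j : Set ℓ} → ∀ κ → Not i → j → Not (status κ i j)
  status-false 𝐛 ¬i j (i , _)  = ¬i i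
  status-false 𝐭 ¬i j (i , _)  = ¬i i
  status-false 𝐧 ¬i j (¬j , _) = ¬j j

  status-realm : {i j : Set ℓ} → ∀ κ → status κ i j → i ⊎ Not j
  status-realm 𝐛 = inj₁ ∘ proj₁
  status-realm 𝐭 = inj₁ ∘ proj₁
  status-realm 𝐧 = inj₂ ∘ proj₁

  part : Status → M → M → Set ℓ
  part κ A x = status κ (x ∈⁺ A) (x ∈⁻ A)

  Part : Status → Fin n → Fin n → Formula n
  Part 𝐛 = PartB
  Part 𝐭 = PartT
  Part 𝐧 = PartN

  Part⟺ : ∀ κ → T (X ∷ A ∷ []) (Part κ v₀ v₁) ⟺ Cl X (part κ A)
  Part⟺ {X} {A} 𝐛 =
    (λ h x → ⟺-trans (proj₁ (h x)) (⟺-sym ⁺) , ⟺-trans (proj₂ (h x)) (⟺-sym ⁻)) ,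
    (λ h x → ⟺-trans (proj₁ (h x)) ⁺ , ⟺-trans (proj₂ (h x)) ⁻)
    where
    ⁺ : part 𝐛 A x ⟺ (x ∈⁺ A × ⊤) × (x ∈⁻ A × ⊤)
    ⁺ = (λ (i , j) → (i , tt) , (j , tt)) , (λ ((i , _) , (j , _)) → i , j)
    ⁻ : Not (part 𝐛 A x) ⟺ (Not (x ∈⁺ A) ⊎ Not (x ∈⁻ A))
    ⁻ = (λ k → dne λ l → l (inj₁ λ i → l (inj₂ λ j → k (i , j)))) ,
        [ (λ ¬i (i , _) → ¬i i) , (λ ¬j (_ , j) → ¬j j) ]
  Part⟺ {X} {A} 𝐭 =
    (λ h x → ⟺-trans (proj₁ (h x)) (⟺-sym ⁺) , ⟺-trans (proj₂ (h x)) (⟺-sym ⁻)) ,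
    (λ h x → ⟺-trans (proj₁ (h x)) ⁺ , ⟺-trans (proj₂ (h x)) ⁻)
    where
    ⁺ : part 𝐭 A x ⟺ (x ∈⁺ A × ⊤) × Not (x ∈⁻ A)
    ⁺ = (λ (i , j) → (i , tt) , j) , (λ ((i , _) , j) → i , j)
    ⁻ : Not (part 𝐭 A x) ⟺ (Not (x ∈⁺ A) ⊎ (x ∈⁻ A × ⊤))
    ⁻ = (λ k → dne λ l → l (inj₁ λ i → k (i , λ j → l (inj₂ (j , tt))))) ,
        [ (λ ¬i (i , _) → ¬i i) , (λ (j , _) (_ , ¬j) → ¬j j) ]
  Part⟺ {X} {A} 𝐧 =
    (λ h x → proj₁ (h x) , ⟺-trans (proj₂ (h x)) (⟺-sym ⁻)) ,
    (λ h x → proj₁ (h x) , ⟺-trans (proj₂ (h x)) ⁻)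
    where
    ⁻ : Not (part 𝐧 A x) ⟺ ((x ∈⁻ A × ⊤) ⊎ (x ∈⁺ A × ⊤))
    ⁻ = (λ k → dne λ l → k ((λ j → l (inj₁ (j , tt))) , (λ i → l (inj₂ (i , tt))))) ,
        [ (λ (j , _) (¬j , _) → ¬j j) , (λ (i , _) (_ , ¬i) → ¬i i) ]

  part-set : ∀ κ A → ∃ λ X → Cl X (part κ A)
  part-set κ A = exists κ (bounded-⊆ (λ _ → status-realm κ) (realm-bounded A))
    where
    exists : ∀ κ → Bounded (part κ A) → ∃ λ X → Cl X (part κ A)
    exists 𝐛 = bounded⇒classical (v₀ ∈̇ v₁ ∧ ∼ v₀ ∈̇ v₁) (A ∷ [])
    exists 𝐭 = bounded⇒classical (v₀ ∈̇ v₁ ∧ ¿ v₀ ∈̇ v₁) (A ∷ [])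
    exists 𝐧 = bounded⇒classical (¿ v₀ ∈̇ v₁ ∧ ¬̇ v₀ ∈̇ v₁) (A ∷ [])

  bang-set : ∀ A → ∃ λ X → Cl X (_∈⁺ A)
  bang-set A = bounded⇒classical (v₀ ∈̇ v₁) (A ∷ []) (∈⁺-bounded A)

  query-set : ∀ A → ∃ λ X → Cl X (λ x → Not (x ∈⁻ A))
  query-set A = bounded⇒classical (¿ v₀ ∈̇ v₁) (A ∷ [])
    (bounded-⊆ (λ _ → inj₂) (realm-bounded A))

  -- Cardinal numbers as coded triples

  cardinality⟺ : {Φ : M → Set ℓ} → (∀ X → Φ X ⟺ Cl X P) → (∃ λ X → Cl X P) →
    (∃ λ X → Φ X × T (c ∷ X ∷ []) (ClCard v₀ v₁)) ⟺ IsCard c P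
  cardinality⟺ {c = c} h (X , hX) =
    (λ (Y , φ , k) → proj₁ (ClCard⟺ {X = Y} {c = c} (proj₁ (h Y) φ)) k) ,
    (λ k → X , proj₂ (h X) hX , proj₂ (ClCard⟺ {X = X} {c = c} hX) k)

  record Code (k c! c? ct cb cn : M) : Set ℓ where
    field
      {fst snd thd} : M
      fst-angle     : Is fst (_∈⁺ c!) (λ x → Not (x ∈⁺ c?))
      snd-angle     : Is snd (_∈⁺ ct) (λ x → Not (x ∈⁺ c?))
      thd-angle     : Is thd (_∈⁺ cb) (λ x → Not (x ∈⁺ cn))
      triple        : T (k ∷ fst ∷ snd ∷ thd ∷ []) (Triple v₀ v₁ v₂ v₃)

  record HasCard (k A : M) : Set ℓ where
    field
      {size! size?} : M
      {size}        : Status → M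
      card!         : IsCard size! (_∈⁺ A)
      card?         : IsCard size? (λ x → Not (x ∈⁻ A))
      card          : ∀ κ → IsCard (size κ) (part κ A)
      code          : Code k size! size? (size 𝐭) (size 𝐛) (size 𝐧)

  -- The environment is arbitrary because `Card` occurs under varying numbers of binders; `lookup`
  -- past a literal number of new variables reduces, so one statement serves everywhere.
  Card⇒ : (ρ : Vec M n) (i j : Fin n) → T ρ (Card i j) → HasCard (lookup ρ i) (lookup ρ j)
  Card⇒ ρ i j (c! , c? , ct , cb , cn , h! , h? , ht , hb , hn , X , Y , Z , hX , hY , hZ , tr) =
    record
      { size = cs
      ; card! = card!
      ; card? = card?
      ; card  = card
      ; code = record
        { fst-angle = proj₁ (Angle₂⟺ {A = X} (ordinal-Cl (proj₁ card!)) (ordinal-Cl (proj₁ card?))) hX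
        ; snd-angle = proj₁ (Angle₂⟺ {A = Y} (ordinal-Cl (proj₁ (card 𝐭))) (ordinal-Cl (proj₁ card?))) hY
        ; thd-angle = proj₁ (Angle₂⟺ {A = Z} (ordinal-Cl (proj₁ (card 𝐛))) (ordinal-Cl (proj₁ (card 𝐧)))) hZ
        ; triple = tr } }
    where
    W = lookup ρ j
    cs : Status → M
    cs 𝐛 = cb
    cs 𝐭 = ct
    cs 𝐧 = cn
    card! : IsCard c! (_∈⁺ W)
    card! = proj₁ (cardinality⟺ (λ X → Bang⟺ {X} {W}) (bang-set W)) h!
    card? : IsCard c? (λ x → Not (x ∈⁻ W))
    card? = proj₁ (cardinality⟺ (λ X → Query⟺ {X} {W}) (query-set W)) h?
    card : ∀ κ → IsCard (cs κ) (part κ W)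
    card 𝐛 = proj₁ (cardinality⟺ (λ X → Part⟺ {X} {W} 𝐛) (part-set 𝐛 W)) hb
    card 𝐭 = proj₁ (cardinality⟺ (λ X → Part⟺ {X} {W} 𝐭) (part-set 𝐭 W)) ht
    card 𝐧 = proj₁ (cardinality⟺ (λ X → Part⟺ {X} {W} 𝐧) (part-set 𝐧 W)) hn

  ⇒Card : (ρ : Vec M n) (i j : Fin n) → HasCard (lookup ρ i) (lookup ρ j) → T ρ (Card i j)
  ⇒Card ρ i j h =
    size! , size? , size 𝐭 , size 𝐛 , size 𝐧 ,
    proj₂ (cardinality⟺ (λ X → Bang⟺ {X} {W}) (bang-set W)) card! ,
    proj₂ (cardinality⟺ (λ X → Query⟺ {X} {W}) (query-set W)) card? ,
    proj₂ (cardinality⟺ (λ X → Part⟺ {X} {W} 𝐭) (part-set 𝐭 W)) (card 𝐭) ,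
    proj₂ (cardinality⟺ (λ X → Part⟺ {X} {W} 𝐛) (part-set 𝐛 W)) (card 𝐛) ,
    proj₂ (cardinality⟺ (λ X → Part⟺ {X} {W} 𝐧) (part-set 𝐧 W)) (card 𝐧) ,
    fst , snd , thd ,
    proj₂ (Angle₂⟺ {A = fst} (ordinal-Cl (proj₁ card!)) (ordinal-Cl (proj₁ card?))) fst-angle ,
    proj₂ (Angle₂⟺ {A = snd} (ordinal-Cl (proj₁ (card 𝐭))) (ordinal-Cl (proj₁ card?))) snd-angle ,
    proj₂ (Angle₂⟺ {A = thd} (ordinal-Cl (proj₁ (card 𝐛))) (ordinal-Cl (proj₁ (card 𝐧)))) thd-angle ,
    triple
    where
    W = lookup ρ j
    open HasCard h
    open Code code

  code-exists : ∀ c! c? ct cb cn → ∃ λ k → Code k c! c? ct cb cn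
  code-exists c! c? ct cb cn =
    let X , hX = angle c! c? ; Y , hY = angle ct c? ; Z , hZ = angle cb cn
        q , hq = ordered-pair Y Z ; k , hk = ordered-pair X q
    in k , record { fst-angle = hX ; snd-angle = hY ; thd-angle = hZ ; triple = q , hq , hk }

  triple-unique : ∀ {X Y Z X′ Y′ Z′ k k′} → X ≡ X′ → Y ≡ Y′ → Z ≡ Z′ →
    T (k ∷ X ∷ Y ∷ Z ∷ []) (Triple v₀ v₁ v₂ v₃) →
    T (k′ ∷ X′ ∷ Y′ ∷ Z′ ∷ []) (Triple v₀ v₁ v₂ v₃) → k ≡ k′
  triple-unique {X} {k = k} {k′} refl refl refl (q , hq , hk) (q′ , hq′ , hk′) =
    pair-unique hk (subst (IsPair k′ X) (sym (pair-unique hq hq′)) hk′)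

  triple-injective : ∀ {X Y Z X′ Y′ Z′ k} →
    T (k ∷ X ∷ Y ∷ Z ∷ []) (Triple v₀ v₁ v₂ v₃) →
    T (k ∷ X′ ∷ Y′ ∷ Z′ ∷ []) (Triple v₀ v₁ v₂ v₃) → X ≡ X′ × Y ≡ Y′ × Z ≡ Z′
  triple-injective {Y′ = Y′} {Z′} (q , hq , hk) (q′ , hq′ , hk′) =
    let x , q≡ = pair-injective hk hk′
        y , z  = pair-injective hq (subst (λ q → IsPair q Y′ Z′) (sym q≡) hq′)
    in x , y , z

  code-unique : ∀ {k k′ c! c? ct cb cn d! d? dt db dn} →
    c! ≡ d! → c? ≡ d? → ct ≡ dt → cb ≡ db → cn ≡ dn →
    Code k c! c? ct cb cn → Code k′ d! d? dt db dn → k ≡ k′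
  code-unique refl refl refl refl refl h h′ = triple-unique
    (Is-unique (Code.fst-angle h) (Code.fst-angle h′)) (Is-unique (Code.snd-angle h) (Code.snd-angle h′))
    (Is-unique (Code.thd-angle h) (Code.thd-angle h′)) (Code.triple h) (Code.triple h′)

  -- Ordinals are classical, so the truth side of ⟨a|b⟩ determines `a`. In the companion `angle-⁻`
  -- the falsity side determines `b`, up to double negation.
  angle-⁺ : X ≡ Y → IsOrdinal a → IsOrdinal b → Is X (_∈⁺ a) P → Is Y (_∈⁺ b) Q → a ≡ b
  angle-⁺ refl oa ob h k = Is-unique (ordinal-Cl oa)
    (Cl-cong (λ x → ⟺-trans (⟺-sym (proj₁ (k x))) (proj₁ (h x))) (ordinal-Cl ob))

  angle-⁻ : X ≡ Y → IsOrdinal a → IsOrdinal b →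
    Is X P (λ x → Not (x ∈⁺ a)) → Is Y Q (λ x → Not (x ∈⁺ b)) → a ≡ b
  angle-⁻ refl oa ob h k = Is-unique (ordinal-Cl oa)
    (Cl-cong (λ x →
      let e = ⟺-trans (⟺-sym (proj₂ (k x))) (proj₂ (h x)) in
      (λ i → dne λ j → proj₂ e j i) , (λ i → dne λ j → proj₁ e j i)) (ordinal-Cl ob))

  HasCard-unique : ∀ {k k′} → HasCard k A → HasCard k′ A → k ≡ k′
  HasCard-unique h h′ = code-unique
    (IsCard-unique (H.card!) (H′.card!)) (IsCard-unique (H.card?) (H′.card?))
    (IsCard-unique (H.card 𝐭) (H′.card 𝐭)) (IsCard-unique (H.card 𝐛) (H′.card 𝐛))
    (IsCard-unique (H.card 𝐧) (H′.card 𝐧)) H.code H′.code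
    where
    module H = HasCard h
    module H′ = HasCard h′

  HasCard⇒≋ : ∀ {k} → HasCard k A → HasCard k B → ∀ κ → part κ A ≋ part κ B
  HasCard⇒≋ {A} {B} h h′ κ =
    IsCard⇒≋ (H.card κ) (subst (λ c → IsCard c (part κ B)) (sym (c≡ κ)) (H′.card κ))
    where
    module H = HasCard h
    module H′ = HasCard h′
    module C = Code H.code
    module C′ = Code H′.code
    same = triple-injective C.triple C′.triple
    -- The size of 𝐭 is the truth side of the second component; those of 𝐛 and 𝐧 are the two sides
    -- of the third.
    c≡ : ∀ κ → H.size κ ≡ H′.size κ
    c≡ 𝐛 = angle-⁺ (proj₂ (proj₂ same)) (proj₁ (H.card 𝐛)) (proj₁ (H′.card 𝐛)) C.thd-angle C′.thd-angle
    c≡ 𝐭 = angle-⁺ (proj₁ (proj₂ same)) (proj₁ (H.card 𝐭)) (proj₁ (H′.card 𝐭)) C.snd-angle C′.snd-angle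
    c≡ 𝐧 = angle-⁻ (proj₂ (proj₂ same)) (proj₁ (H.card 𝐧)) (proj₁ (H′.card 𝐧)) C.thd-angle C′.thd-angle

  HasCard-exists : ∀ {c! c?} {c : Status → M} → IsCard c! (_∈⁺ A) → IsCard c? (λ x → Not (x ∈⁻ A)) →
    (∀ κ → IsCard (c κ) (part κ A)) → ∃ λ k → HasCard k A
  HasCard-exists {c! = c!} {c?} {c} h! h? h =
    let k , hk = code-exists c! c? (c 𝐭) (c 𝐛) (c 𝐧) in
    k , record { size = c ; card! = h! ; card? = h? ; card = h ; code = hk }

  bang⟺ : ∀ x → (part 𝐛 A x ⊎ part 𝐭 A x) ⟺ x ∈⁺ A
  bang⟺ {A} x = [ proj₁ , proj₁ ] , λ i → [ (λ j → inj₁ (i , j)) , (λ ¬j → inj₂ (i , ¬j)) ] (lem (x ∈⁻ A))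

  query⟺ : ∀ x → (part 𝐭 A x ⊎ part 𝐧 A x) ⟺ Not (x ∈⁻ A)
  query⟺ {A} x = [ proj₂ , proj₁ ] , λ j → [ (λ i → inj₁ (i , j)) , (λ ¬i → inj₂ (j , ¬i)) ] (lem (x ∈⁺ A))

  Disjoint : (P Q : M → Set ℓ) → Set ℓ
  Disjoint P Q = ∀ x → P x → Q x → ⊥ {ℓ}

  𝐛-𝐭-disjoint : ∀ A → Disjoint (part 𝐛 A) (part 𝐭 A)
  𝐛-𝐭-disjoint A x (_ , j) (_ , ¬j) = ¬j j

  𝐭-𝐧-disjoint : ∀ A → Disjoint (part 𝐭 A) (part 𝐧 A)
  𝐭-𝐧-disjoint A x (i , _) (_ , ¬i) = ¬i i

  bang-≋ : part 𝐛 A ≋ P → part 𝐭 A ≋ Q → Disjoint P Q → (_∈⁺ A) ≋ (λ x → P x ⊎ Q x)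
  bang-≋ {A} h k d = ≋-cong bang⟺ (λ _ → ⟺-refl) (≋-∪ h k (𝐛-𝐭-disjoint A) d)

  query-≋ : part 𝐭 A ≋ P → part 𝐧 A ≋ Q → Disjoint P Q → (λ x → Not (x ∈⁻ A)) ≋ (λ x → P x ⊎ Q x)
  query-≋ {A} h k d = ≋-cong query⟺ (λ _ → ⟺-refl) (≋-∪ h k (𝐭-𝐧-disjoint A) d)

  HasCard-≋ : ∀ {k} → (∀ κ → part κ A ≋ part κ B) → HasCard k A → HasCard k B
  HasCard-≋ {A} {B} e h = record
    { size  = H.size
    ; card! = IsCard-≋ (≋-cong (λ _ → ⟺-refl) bang⟺ (bang-≋ (e 𝐛) (e 𝐭) (𝐛-𝐭-disjoint B))) H.card!
    ; card? = IsCard-≋ (≋-cong (λ _ → ⟺-refl) query⟺ (query-≋ (e 𝐭) (e 𝐧) (𝐭-𝐧-disjoint B))) H.card?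
    ; card  = λ κ → IsCard-≋ (e κ) (H.card κ)
    ; code  = H.code
    }
    where module H = HasCard h

  -- Prescribed parts and existence of cardinals

  None : M → Set ℓ
  None _ = ⊥

  -- The arguments follow the summands of the decomposition: 𝐭, then 𝐛, then 𝐧.
  mix : (P Q R : M → Set ℓ) → Status → M → Set ℓ
  mix P Q R 𝐭 = P
  mix P Q R 𝐛 = Q
  mix P Q R 𝐧 = R

  only : Status → (M → Set ℓ) → Status → M → Set ℓ
  only 𝐭 P = mix P None None
  only 𝐛 P = mix None P None
  only 𝐧 P = mix None None P

  None-≋ : None ≋ None
  None-≋ = Empty≋ (λ _ → id) (λ _ → id)

  ≋None⇒empty : P ≋ None → ∀ x → Not (P x)
  ≋None⇒empty h = ≋-empty (≋-sym h) (λ _ → id)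

  empty⇒≋None : (∀ x → Not (P x)) → P ≋ None
  empty⇒≋None h = Empty≋ h (λ _ → id)

  HasParts : M → (Status → M → Set ℓ) → Set ℓ
  HasParts A Ps = ∀ κ → part κ A ≋ Ps κ

  -- `SumOf` and `ProductOf` pick arbitrary representatives of their cardinals. By `shape-at`, a
  -- shape found for one representative holds for all, so it is a property of `k`.
  Shape : M → (Status → M → Set ℓ) → Set ℓ
  Shape k Ps = ∃ λ A → HasCard k A × HasParts A Ps

  shape-at : ∀ {k Ps} → Shape k Ps → HasCard k A → HasParts A Ps
  shape-at (B , h , e) k κ = ≋-trans (HasCard⇒≋ k h κ) (e κ)

  shape-≋ : ∀ {k Ps Qs} → Shape k Ps → Shape k Qs → ∀ κ → Ps κ ≋ Qs κ
  shape-≋ s@(A , h , e) s′ κ = ≋-trans (≋-sym (e κ)) (shape-at s′ h κ)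

  shape-unique : ∀ {k k′ Ps Qs} → Shape k Ps → Shape k′ Qs → (∀ κ → Ps κ ≋ Qs κ) → k ≡ k′
  shape-unique (A , h , e) (B , h′ , e′) f = HasCard-unique
    (HasCard-≋ (λ κ → ≋-trans (e κ) (≋-trans (f κ) (≋-sym (e′ κ)))) h) h′

  only-𝐭-≋ : P ≋ Q → ∀ κ → only 𝐭 P κ ≋ only 𝐭 Q κ
  only-𝐭-≋ h 𝐛 = None-≋
  only-𝐭-≋ h 𝐭 = h
  only-𝐭-≋ h 𝐧 = None-≋

  classical-parts : Cl X P → HasParts X (only 𝐭 P)
  classical-parts h 𝐛 = empty⇒≋None λ x (i , j) → proj₁ (proj₂ (h x)) j (proj₁ (proj₁ (h x)) i)
  classical-parts h 𝐭 = ≋-cong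
    (λ x → (λ p → let i = proj₂ (proj₁ (h x)) p in i , λ j → proj₁ (proj₂ (h x)) j p)
         , (λ (i , _) → proj₁ (proj₁ (h x)) i))
    (λ _ → ⟺-refl) (≋-refl h)
  classical-parts h 𝐧 = empty⇒≋None λ x (¬j , ¬i) →
    ¬j (proj₂ (proj₂ (h x)) λ p → ¬i (proj₂ (proj₁ (h x)) p))

  -- Without gluts and gaps, membership is exactly one of true and false. This makes every
  -- representative of a classical cardinal classical.
  parts⇒classical : HasParts X (only 𝐭 P) → Cl X (_∈⁺ X)
  parts⇒classical h x = ⟺-refl ,
    (λ j i → ≋None⇒empty (h 𝐛) x (i , j)) ,
    (λ ¬i → dne λ ¬j → ≋None⇒empty (h 𝐧) x (¬j , ¬i))

  HasSize : (M → Set ℓ) → Set ℓ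
  HasSize P = ∃ λ c → IsCard c P

  size-≋ : P ≋ Q → HasSize Q → HasSize P
  size-≋ h (c , k) = c , IsCard-≋ (≋-sym h) k

  size-None : HasSize None
  size-None = let e , he = empty in e , IsCard-0 he (λ _ → id)

  size-singleton : Cl e None → HasSize (_≡ e)
  size-singleton {e} he = let s , hs = singleton e in s , IsCard-1 he hs (≋-refl hs)

  sizes⇒HasCard : HasSize (_∈⁺ A) → HasSize (λ x → Not (x ∈⁻ A)) → (∀ κ → HasSize (part κ A)) →
    ∃ λ k → HasCard k A
  sizes⇒HasCard (_ , h!) (_ , h?) h = HasCard-exists h! h? (λ κ → proj₂ (h κ))

  size-∪-None : HasSize P → HasSize (λ x → P x ⊎ None x)
  -- `≋-refl` asks for a classical set with extension `P`; going to the ordinal and back by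
  -- `IsCard⇒≋` gives `P ≋ P` directly.
  size-∪-None {P} (c , h) = c , IsCard-≋ (≋-cong (λ _ → ⟺-refl) (λ _ → inj₁ , [ id , ⊥-elim ])
    (IsCard⇒≋ {P = P} h h)) h

  size-None-∪ : HasSize P → HasSize (λ x → None x ⊎ P x)
  size-None-∪ {P} (c , h) = c , IsCard-≋ (≋-cong (λ _ → ⟺-refl) (λ _ → inj₂ , [ ⊥-elim , id ])
    (IsCard⇒≋ {P = P} h h)) h

  -- The unions are copies of A^! and A^?. Their ordinals are premises, since ordinals for the
  -- pieces do not directly yield one for a union; they will come from κ or from an empty summand.
  HasCard-mix : HasParts A (mix P Q R) → Disjoint Q P → Disjoint P R →
    HasSize P → HasSize Q → HasSize R → HasSize (λ x → Q x ⊎ P x) → HasSize (λ x → P x ⊎ R x) →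
    ∃ λ k → HasCard k A
  HasCard-mix h d d′ p q r qp pr = sizes⇒HasCard
    (size-≋ (bang-≋ (h 𝐛) (h 𝐭) d) qp)
    (size-≋ (query-≋ (h 𝐭) (h 𝐧) d′) pr)
    λ { 𝐛 → size-≋ (h 𝐛) q ; 𝐭 → size-≋ (h 𝐭) p ; 𝐧 → size-≋ (h 𝐧) r }

  HasCard-only : ∀ κ → HasParts A (only κ P) → HasSize P → ∃ λ k → HasCard k A
  HasCard-only 𝐭 h p = HasCard-mix h (λ _ ()) (λ _ _ ()) p size-None size-None
    (size-None-∪ p) (size-∪-None p)
  HasCard-only 𝐛 h p = HasCard-mix h (λ _ _ ()) (λ _ ()) size-None p size-None
    (size-∪-None p) (size-∪-None size-None)
  HasCard-only 𝐧 h p = HasCard-mix h (λ _ ()) (λ _ ()) size-None size-None p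
    (size-∪-None size-None) (size-None-∪ p)

  -- Disjoint unions

  PairZero⟺ : Cl e None → T (p ∷ x ∷ []) (PairZero v₀ v₁) ⟺ IsPair p x e
  PairZero⟺ {e} {p} {x} he =
    (λ (e′ , he′ , pr) → subst (IsPair p x) (Is-unique (proj₂ Is-empty he′) he) pr) ,
    (λ pr → e , proj₁ Is-empty he , pr)

  PairOne⟺ : Cl e None → Cl s (_≡ e) → T (p ∷ x ∷ []) (PairOne v₀ v₁) ⟺ IsPair p x s
  PairOne⟺ {e} {s} {p} {x} he hs =
    (λ (e′ , s′ , he′ , hs′ , pr) → subst (IsPair p x)
      (Is-unique (proj₂ Is-singleton hs′)
        (subst (λ e → Cl s (_≡ e)) (sym (Is-unique (proj₂ Is-empty he′) he)) hs)) pr) ,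
    (λ pr → e , s , proj₁ Is-empty he , proj₁ Is-singleton hs , pr)

  IsSum IsProduct : M → M → M → Set ℓ
  IsSum S A B = T (S ∷ A ∷ B ∷ []) (DisjointUnion v₀ v₁ v₂)
  IsProduct V A B = T (V ∷ A ∷ B ∷ []) (Product v₀ v₁ v₂)

  module _ (he : Cl e None) (hs : Cl s (_≡ e)) where

    0≢1 : IsPair p x e → IsPair p y s → ⊥ {ℓ}
    0≢1 h k = proj₁ (proj₁ (he e))
      (subst (e ∈⁺_) (sym (proj₂ (pair-injective h k))) (proj₂ (proj₁ (hs e)) refl))

    sum-left : IsSum S A B → IsPair p x e → (p ∈⁺ S ⟺ x ∈⁺ A) × (p ∈⁻ S ⟺ x ∈⁻ A)
    sum-left {S} {A} {B} {p} {x} h pr =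
      ⟺-trans (proj₁ (h p))
        ( [ (λ (y , t , i) → subst (_∈⁺ A) (proj₁ (pair-injective (proj₁ (PairZero⟺ he) t) pr)) i)
          , (λ (y , t , _) → ⊥-elim (0≢1 pr (proj₁ (PairOne⟺ he hs) t))) ]
        , λ i → inj₁ (x , proj₂ (PairZero⟺ he) pr , i)) ,
      ⟺-trans (proj₂ (h p))
        ( (λ (k , _) → k x (proj₂ (PairZero⟺ he) pr))
        , λ j → (λ y t → subst (_∈⁻ A) (proj₁ (pair-injective pr (proj₁ (PairZero⟺ he) t))) j)
              , (λ y t → ⊥-elim (0≢1 pr (proj₁ (PairOne⟺ he hs) t))))

    sum-right : IsSum S A B → IsPair p x s → (p ∈⁺ S ⟺ x ∈⁺ B) × (p ∈⁻ S ⟺ x ∈⁻ B)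
    sum-right {S} {A} {B} {p} {x} h pr =
      ⟺-trans (proj₁ (h p))
        ( [ (λ (y , t , _) → ⊥-elim (0≢1 (proj₁ (PairZero⟺ he) t) pr))
          , (λ (y , t , i) → subst (_∈⁺ B) (proj₁ (pair-injective (proj₁ (PairOne⟺ he hs) t) pr)) i) ]
        , λ i → inj₂ (x , proj₂ (PairOne⟺ he hs) pr , i)) ,
      ⟺-trans (proj₂ (h p))
        ( (λ (_ , k) → k x (proj₂ (PairOne⟺ he hs) pr))
        , λ j → (λ y t → ⊥-elim (0≢1 (proj₁ (PairZero⟺ he) t) pr))
              , (λ y t → subst (_∈⁻ B) (proj₁ (pair-injective pr (proj₁ (PairOne⟺ he hs) t))) j))

    -- At a tagged pair, `S` copies both truth and falsity from the summand. Any other `p` cannot be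
    -- a true member, and its falsity clause holds vacuously, so it is in no part.
    sum-part : IsSum S A B → ∀ κ p → part κ S p ⟺ (Tagged e (part κ A) p ⊎ Tagged s (part κ B) p)
    sum-part {S} {A} {B} h κ p = to , from
      where
      from : Tagged e (part κ A) p ⊎ Tagged s (part κ B) p → part κ S p
      from (inj₁ (x , i , pr)) =
        proj₂ (status-cong κ (proj₁ (sum-left h pr)) (proj₂ (sum-left h pr))) i
      from (inj₂ (x , i , pr)) =
        proj₂ (status-cong κ (proj₁ (sum-right h pr)) (proj₂ (sum-right h pr))) i
      to : part κ S p → Tagged e (part κ A) p ⊎ Tagged s (part κ B) p
      to i = dne λ k →
        let ¬0 = λ x (t : T (p ∷ x ∷ []) (PairZero v₀ v₁)) → let pr = proj₁ (PairZero⟺ he) t in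
              k (inj₁ (x , proj₁ (status-cong κ (proj₁ (sum-left h pr)) (proj₂ (sum-left h pr))) i , pr))
            ¬1 = λ x (t : T (p ∷ x ∷ []) (PairOne v₀ v₁)) → let pr = proj₁ (PairOne⟺ he hs) t in
              k (inj₂ (x , proj₁ (status-cong κ (proj₁ (sum-right h pr)) (proj₂ (sum-right h pr))) i , pr))
        in status-false κ
             (λ j → [ (λ (x , t , _) → ¬0 x t) , (λ (x , t , _) → ¬1 x t) ] (proj₁ (proj₁ (h p)) j))
             (proj₂ (proj₂ (h p)) ((λ x t → ⊥-elim (¬0 x t)) , (λ x t → ⊥-elim (¬1 x t))))
             i

  part-≋-tagged : ∀ κ A e → Tagged e (part κ A) ≋ part κ A
  part-≋-tagged κ A e = ≋-sym (tagged-≋ (proj₂ (part-set κ A)) e)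

  -- Together with `sum-≋ʳ` this covers every addition in the decomposition, as in each status one
  -- of the two summands is empty.
  sum-≋ˡ : IsSum S A B → ∀ κ → part κ B ≋ None → part κ S ≋ part κ A
  sum-≋ˡ {S} {A} {B} h κ hB =
    let e , he = empty ; s , hs = singleton e in
    ≋-cong (λ p → (λ i → proj₂ (sum-part he hs h κ p) (inj₁ i))
                , (λ i → [ id , (λ (x , j , _) → ⊥-elim (≋None⇒empty hB x j)) ]
                           (proj₁ (sum-part he hs h κ p) i)))
           (λ _ → ⟺-refl) (part-≋-tagged κ A e)

  sum-≋ʳ : IsSum S A B → ∀ κ → part κ A ≋ None → part κ S ≋ part κ B
  sum-≋ʳ {S} {A} {B} h κ hA =
    let e , he = empty ; s , hs = singleton e in
    ≋-cong (λ p → (λ i → proj₂ (sum-part he hs h κ p) (inj₂ i))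
                , (λ i → [ (λ (x , j , _) → ⊥-elim (≋None⇒empty hA x j)) , id ]
                           (proj₁ (sum-part he hs h κ p) i)))
           (λ _ → ⟺-refl) (part-≋-tagged κ B s)

  sum-exists : ∀ A B → ∃ λ S → IsSum S A B
  sum-exists A B =
    let e , he = empty ; s , hs = singleton e in
    bounded⇒set (∃̇ (PairZero v₁ v₀ & v₀ ∈̇ v₂) ∨ ∃̇ (PairOne v₁ v₀ & v₀ ∈̇ v₃)) (A ∷ B ∷ [])
      (∪-image-bounded
        (image-bounded (PairZero v₁ v₀) []
          (λ h k → pair-unique (proj₁ (PairZero⟺ he) h) (proj₁ (PairZero⟺ he) k))
          (realm-bounded A))
        (image-bounded (PairOne v₁ v₀) []
          (λ h k → pair-unique (proj₁ (PairOne⟺ he hs) h) (proj₁ (PairOne⟺ he hs) k))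
          (realm-bounded B)))

  -- Products

  product-exists : ∀ A B → ∃ λ V → IsProduct V A B
  product-exists A B =
    bounded⇒set (∃̇ ∃̇ (Pair v₂ v₁ v₀ & (v₁ ∈̇ v₃ ∧ v₀ ∈̇ v₄))) (A ∷ B ∷ [])
      (bounded-⊆
        (λ p →
          [ (λ (x , y , pr , i , j) → x , y , inj₁ i , inj₁ j , pr)
          , (λ k → dne λ l → k λ x y pr → dne λ m →
              l (x , y , inj₂ (m ∘ inj₁) , inj₂ (m ∘ inj₂) , pr)) ])
        (×-bounded (realm-bounded A) (realm-bounded B)))

  product-pair : IsProduct V A B → IsPair p x y →
    (p ∈⁺ V ⟺ (x ∈⁺ A × y ∈⁺ B)) × (p ∈⁻ V ⟺ (x ∈⁻ A ⊎ y ∈⁻ B))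
  product-pair {V} {A} {B} {p} {x} {y} h pr =
    ⟺-trans (proj₁ (h p))
      ( (λ (x′ , y′ , pr′ , i , j) → let x≡ , y≡ = pair-injective pr′ pr in
           subst (_∈⁺ A) x≡ i , subst (_∈⁺ B) y≡ j)
      , (λ (i , j) → x , y , pr , i , j)) ,
    ⟺-trans (proj₂ (h p))
      ( (λ k → k x y pr)
      , (λ k x′ y′ pr′ → let x≡ , y≡ = pair-injective pr pr′ in
           [ (λ i → inj₁ (subst (_∈⁻ A) x≡ i)) , (λ j → inj₂ (subst (_∈⁻ B) y≡ j)) ] k))

  -- With `A` classical, a pair over `x ∈ A` inherits the status of its second coordinate in `B`; a
  -- pair over any other `x` is only false.
  product-part : IsProduct V A B → Cl A (_∈⁺ A) → ∀ κ p →
    part κ V p ⟺ (∃ λ x → ∃ λ y → IsPair p x y × x ∈⁺ A × part κ B y)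
  product-part {V} {A} {B} h hA κ p = to , from
    where
    inside : IsPair p x y → x ∈⁺ A → part κ V p ⟺ part κ B y
    inside pr i = status-cong κ
      (⟺-trans (proj₁ (product-pair h pr)) (proj₂ , (i ,_)))
      (⟺-trans (proj₂ (product-pair h pr))
        ([ (λ k → ⊥-elim (proj₁ (proj₂ (hA _)) k i)) , id ] , inj₂))
    from : (∃ λ x → ∃ λ y → IsPair p x y × x ∈⁺ A × part κ B y) → part κ V p
    from (x , y , pr , i , k) = proj₂ (inside pr i) k
    to : part κ V p → ∃ λ x → ∃ λ y → IsPair p x y × x ∈⁺ A × part κ B y
    to k = dne λ l →
      let ¬inside = λ x y (pr : IsPair p x y) i → l (x , y , pr , i , proj₁ (inside pr i) k) in
      status-false κ
        (λ j → let x , y , pr , i , _ = proj₁ (proj₁ (h p)) j in ¬inside x y pr i)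
        (proj₂ (proj₂ (h p)) λ x y pr → inj₁ (proj₂ (proj₂ (hA x)) (¬inside x y pr)))
        k

  product-None : IsProduct V A B → Cl A (_∈⁺ A) → ∀ κ → part κ B ≋ None → part κ V ≋ None
  product-None h hA κ hB = empty⇒≋None λ p i →
    let x , y , _ , _ , j = proj₁ (product-part h hA κ p) i in ≋None⇒empty hB y j

  ≋-singleton : P ≋ (_≡ e) → ∃ λ a → P a × (∀ {x} → P x → x ≡ a)
  ≋-singleton {e = e} h =
    let a , k = onto h refl in
    a , domain h k , λ px → let y , l = total h px in
      injective h (subst (Maps (graph h) _) (range h l) l) k

  product-singleton : IsProduct V A B → Cl A (_∈⁺ A) → ∀ κ → part κ B ≋ (_≡ e) → part κ V ≋ (_∈⁺ A)
  product-singleton {V} {A} {B} h hA κ hB = by-element (≋-singleton hB)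
    where
    by-element : (∃ λ b → part κ B b × (∀ {y} → part κ B y → y ≡ b)) → part κ V ≋ (_∈⁺ A)
    by-element (b , b∈B , the) =
      ≋-cong {P = Tagged b (_∈⁺ A)} (λ p → to p , from p) (λ _ → ⟺-refl) (≋-sym (tagged-≋ hA b))
      where
      to : ∀ p → Tagged b (_∈⁺ A) p → part κ V p
      to p (x , i , pr) = proj₂ (product-part h hA κ p) (x , b , pr , i , b∈B)
      from : ∀ p → part κ V p → Tagged b (_∈⁺ A) p
      from p k = let x , y , pr , i , j = proj₁ (product-part h hA κ p) k in
        x , i , subst (IsPair p x) (the j) pr

  -- The one-element part of `B` produces a copy of `A` in status `κ`; empty parts of `B` stay
  -- empty. The nine cases only let `only` compute.
  product-parts : ∀ κ → IsProduct V A B → HasParts A (only 𝐭 P) → HasParts B (only κ (_≡ e)) →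
    HasParts V (only κ P)
  product-parts {V} {A} {B} {P} {e} κ h hA hB = by-cases κ hB
    where
    clA : Cl A (_∈⁺ A)
    clA = parts⇒classical hA
    A≋P : (_∈⁺ A) ≋ P
    A≋P = ≋-trans (≋-sym (classical-parts clA 𝐭)) (hA 𝐭)
    unit : ∀ κ → part κ B ≋ (_≡ e) → part κ V ≋ P
    unit κ k = ≋-trans (product-singleton h clA κ k) A≋P
    by-cases : ∀ κ → HasParts B (only κ (_≡ e)) → HasParts V (only κ P)
    by-cases 𝐛 hB 𝐛 = unit 𝐛 (hB 𝐛)
    by-cases 𝐛 hB 𝐭 = product-None h clA 𝐭 (hB 𝐭)
    by-cases 𝐛 hB 𝐧 = product-None h clA 𝐧 (hB 𝐧)
    by-cases 𝐭 hB 𝐛 = product-None h clA 𝐛 (hB 𝐛)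
    by-cases 𝐭 hB 𝐭 = unit 𝐭 (hB 𝐭)
    by-cases 𝐭 hB 𝐧 = product-None h clA 𝐧 (hB 𝐧)
    by-cases 𝐧 hB 𝐛 = product-None h clA 𝐛 (hB 𝐛)
    by-cases 𝐧 hB 𝐭 = product-None h clA 𝐭 (hB 𝐭)
    by-cases 𝐧 hB 𝐧 = unit 𝐧 (hB 𝐧)

  sum-𝐭-𝐛 : IsSum S A B → HasParts A (only 𝐭 P) → HasParts B (only 𝐛 Q) → HasParts S (mix P Q None)
  sum-𝐭-𝐛 h hA hB 𝐭 = ≋-trans (sum-≋ˡ h 𝐭 (hB 𝐭)) (hA 𝐭)
  sum-𝐭-𝐛 h hA hB 𝐛 = ≋-trans (sum-≋ʳ h 𝐛 (hA 𝐛)) (hB 𝐛)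
  sum-𝐭-𝐛 h hA hB 𝐧 = ≋-trans (sum-≋ˡ h 𝐧 (hB 𝐧)) (hA 𝐧)

  sum-𝐭𝐛-𝐧 : IsSum S A B → HasParts A (mix P Q None) → HasParts B (only 𝐧 R) → HasParts S (mix P Q R)
  sum-𝐭𝐛-𝐧 h hA hB 𝐭 = ≋-trans (sum-≋ˡ h 𝐭 (hB 𝐭)) (hA 𝐭)
  sum-𝐭𝐛-𝐧 h hA hB 𝐛 = ≋-trans (sum-≋ˡ h 𝐛 (hB 𝐛)) (hA 𝐛)
  sum-𝐭𝐛-𝐧 h hA hB 𝐧 = ≋-trans (sum-≋ʳ h 𝐧 (hA 𝐧)) (hB 𝐧)

  sumOf-shape : ∀ {Ps Qs Rs} (ρ : Vec M n) (i j l : Fin n) →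
    (∀ {S A B} → IsSum S A B → HasParts A Ps → HasParts B Qs → HasParts S Rs) →
    Shape (lookup ρ j) Ps → Shape (lookup ρ l) Qs → T ρ (SumOf i j l) → Shape (lookup ρ i) Rs
  sumOf-shape ρ i j l f sj sl (A , B , S , hA , hB , h , hS) =
    S , Card⇒ (S ∷ B ∷ A ∷ ρ) (3 ↑ʳ i) v₀ hS ,
    f {S} {A} {B} h (shape-at sj (Card⇒ (S ∷ B ∷ A ∷ ρ) (3 ↑ʳ j) v₂ hA)) (shape-at sl (Card⇒ (S ∷ B ∷ A ∷ ρ) (3 ↑ʳ l) v₁ hB))

  productOf-shape : (ρ : Vec M n) (i j l : Fin n) → ∀ κ →
    Shape (lookup ρ j) (only 𝐭 P) → Shape (lookup ρ l) (only κ (_≡ e)) →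
    T ρ (ProductOf i j l) → Shape (lookup ρ i) (only κ P)
  productOf-shape ρ i j l κ sj sl (A , B , V , hA , hB , h , hV) =
    V , Card⇒ (V ∷ B ∷ A ∷ ρ) (3 ↑ʳ i) v₀ hV ,
    product-parts {V} {A} {B} κ h
      (shape-at sj (Card⇒ (V ∷ B ∷ A ∷ ρ) (3 ↑ʳ j) v₂ hA)) (shape-at sl (Card⇒ (V ∷ B ∷ A ∷ ρ) (3 ↑ʳ l) v₁ hB))

  sumOf : (ρ : Vec M n) (i j l : Fin n) → HasCard (lookup ρ j) A → HasCard (lookup ρ l) B →
    IsSum S A B → HasCard (lookup ρ i) S → T ρ (SumOf i j l)
  sumOf {A = A} {B} {S} ρ i j l hA hB h hS =
    A , B , S , ⇒Card (S ∷ B ∷ A ∷ ρ) (3 ↑ʳ j) v₂ hA , ⇒Card (S ∷ B ∷ A ∷ ρ) (3 ↑ʳ l) v₁ hB , h , ⇒Card (S ∷ B ∷ A ∷ ρ) (3 ↑ʳ i) v₀ hS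

  productOf : (ρ : Vec M n) (i j l : Fin n) → HasCard (lookup ρ j) A → HasCard (lookup ρ l) B →
    IsProduct V A B → HasCard (lookup ρ i) V → T ρ (ProductOf i j l)
  productOf {A = A} {B} {V} ρ i j l hA hB h hV =
    A , B , V , ⇒Card (V ∷ B ∷ A ∷ ρ) (3 ↑ʳ j) v₂ hA , ⇒Card (V ∷ B ∷ A ∷ ρ) (3 ↑ʳ l) v₁ hB , h , ⇒Card (V ∷ B ∷ A ∷ ρ) (3 ↑ʳ i) v₀ hV

  -- Units and decompositions

  part-≋ : ∀ κ → Cl X P → T (X ∷ A ∷ []) (Part κ v₀ v₁) → part κ A ≋ P
  part-≋ {A = A} κ hX h =
    ≋-cong (Cl-agree hX (proj₁ (Part⟺ {A = A} κ) h)) (λ _ → ⟺-refl) (≋-refl hX)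

  Part-from : ∀ κ → Cl X P → (∀ x → P x ⟺ part κ A x) → T (X ∷ A ∷ []) (Part κ v₀ v₁)
  Part-from {A = A} κ hX e = proj₂ (Part⟺ {A = A} κ) (Cl-cong e hX)

  𝔟-shape : (ρ : Vec M n) (i : Fin n) → Cl e None → T ρ (Is𝔟 i) → Shape (lookup ρ i) (only 𝐛 (_≡ e))
  𝔟-shape ρ i he (e′ , s′ , A , he′ , hs′ , (hb , ht , hn) , h) =
    A , Card⇒ (A ∷ s′ ∷ e′ ∷ ρ) (3 ↑ʳ i) v₀ h , λ
    { 𝐛 → part-≋ 𝐛 (subst (λ e → Cl s′ (_≡ e)) (Is-unique (proj₂ Is-empty he′) he) (proj₂ Is-singleton hs′)) hb
    ; 𝐭 → part-≋ 𝐭 (proj₂ Is-empty he′) ht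
    ; 𝐧 → part-≋ 𝐧 (proj₂ Is-empty he′) hn }

  𝔫-shape : (ρ : Vec M n) (i : Fin n) → Cl e None → T ρ (Is𝔫 i) → Shape (lookup ρ i) (only 𝐧 (_≡ e))
  𝔫-shape ρ i he (e′ , s′ , A , he′ , hs′ , (hb , ht , hn) , h) =
    A , Card⇒ (A ∷ s′ ∷ e′ ∷ ρ) (3 ↑ʳ i) v₀ h , λ
    { 𝐛 → part-≋ 𝐛 (proj₂ Is-empty he′) hb
    ; 𝐭 → part-≋ 𝐭 (proj₂ Is-empty he′) ht
    ; 𝐧 → part-≋ 𝐧 (subst (λ e → Cl s′ (_≡ e)) (Is-unique (proj₂ Is-empty he′) he) (proj₂ Is-singleton hs′)) hn }

  -- The last component ranges over all environments because `Is𝔟` is used under the binders of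
  -- `Decomposition`.
  Unit𝔟 : Set ℓ
  Unit𝔟 = ∃ λ e → ∃ λ k → ∃ λ A → HasCard k A × HasParts A (only 𝐛 (_≡ e)) ×
    (∀ {n} (ρ : Vec M n) (i : Fin n) → HasCard (lookup ρ i) A → T ρ (Is𝔟 i))

  𝔟-exists : Cl e None → Unit𝔟
  𝔟-exists {e = e} he =
    e , k , N₀ , hk , parts ,
    λ ρ i h → e , one , N₀ , proj₁ Is-empty he , proj₁ Is-singleton hs , (hb , ht , hn) ,
              ⇒Card (N₀ ∷ one ∷ e ∷ ρ) (3 ↑ʳ i) v₀ h
    where
    one N₀ k : M
    one = proj₁ (singleton e)
    hs : Cl one (_≡ e)
    hs = proj₂ (singleton e)
    -- Membership in ⟨{∅}|∅⟩ is false everywhere and true at ∅ alone, so ∅ is its sole glut and the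
    -- other parts are empty.
    N₀ = proj₁ (angle-Cl hs he)
    hA : Is N₀ (_≡ e) (λ _ → Not ⊥)
    hA = proj₂ (angle-Cl hs he)
    hb : T (one ∷ N₀ ∷ []) (PartB v₀ v₁)
    hb = Part-from 𝐛 hs λ x →
      (λ i → proj₂ (proj₁ (hA x)) i , proj₂ (proj₂ (hA x)) id) , proj₁ (proj₁ (hA x)) ∘ proj₁
    ht : T (e ∷ N₀ ∷ []) (PartT v₀ v₁)
    ht = Part-from 𝐭 he λ x → ⊥-elim , λ (_ , ¬j) → ¬j (proj₂ (proj₂ (hA x)) id)
    hn : T (e ∷ N₀ ∷ []) (PartN v₀ v₁)
    hn = Part-from 𝐧 he λ x → ⊥-elim , λ (¬j , _) → ¬j (proj₂ (proj₂ (hA x)) id)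
    parts : HasParts N₀ (only 𝐛 (_≡ e))
    parts 𝐛 = part-≋ 𝐛 hs hb
    parts 𝐭 = part-≋ 𝐭 he ht
    parts 𝐧 = part-≋ 𝐧 he hn
    k = proj₁ (HasCard-only 𝐛 parts (size-singleton he))
    hk : HasCard k N₀
    hk = proj₂ (HasCard-only 𝐛 parts (size-singleton he))

  Unit𝔫 : Set ℓ
  Unit𝔫 = ∃ λ e → ∃ λ k → ∃ λ A → HasCard k A × HasParts A (only 𝐧 (_≡ e)) ×
    (∀ {n} (ρ : Vec M n) (i : Fin n) → HasCard (lookup ρ i) A → T ρ (Is𝔫 i))

  𝔫-exists : Cl e None → Unit𝔫
  𝔫-exists {e = e} he =
    e , k , N₀ , hk , parts ,
    λ ρ i h → e , one , N₀ , proj₁ Is-empty he , proj₁ Is-singleton hs , (hb , ht , hn) ,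
              ⇒Card (N₀ ∷ one ∷ e ∷ ρ) (3 ↑ʳ i) v₀ h
    where
    one N₀ k : M
    one = proj₁ (singleton e)
    hs : Cl one (_≡ e)
    hs = proj₂ (singleton e)
    -- Membership in ⟨∅|{∅}⟩ is true nowhere and false except at ∅, so ∅ is its sole gap.
    N₀ = proj₁ (angle-Cl he hs)
    hA : Is N₀ None (λ x → Not (x ≡ e))
    hA = proj₂ (angle-Cl he hs)
    hb : T (e ∷ N₀ ∷ []) (PartB v₀ v₁)
    hb = Part-from 𝐛 he λ x → ⊥-elim , proj₁ (proj₁ (hA x)) ∘ proj₁
    ht : T (e ∷ N₀ ∷ []) (PartT v₀ v₁)
    ht = Part-from 𝐭 he λ x → ⊥-elim , proj₁ (proj₁ (hA x)) ∘ proj₁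
    hn : T (one ∷ N₀ ∷ []) (PartN v₀ v₁)
    hn = Part-from 𝐧 hs λ x →
      (λ i → (λ j → proj₁ (proj₂ (hA x)) j i) , proj₁ (proj₁ (hA x))) ,
      (λ (¬j , _) → dne λ ne → ¬j (proj₂ (proj₂ (hA x)) ne))
    parts : HasParts N₀ (only 𝐧 (_≡ e))
    parts 𝐛 = part-≋ 𝐛 he hb
    parts 𝐭 = part-≋ 𝐭 he ht
    parts 𝐧 = part-≋ 𝐧 hs hn
    k = proj₁ (HasCard-only 𝐧 parts (size-singleton he))
    hk : HasCard k N₀
    hk = proj₂ (HasCard-only 𝐧 parts (size-singleton he))

  classicalCardinal-shape : (ρ : Vec M n) (i : Fin n) → T ρ (ClassicalCardinal i) →
    ∃ λ P → Shape (lookup ρ i) (only 𝐭 P)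
  classicalCardinal-shape ρ i (A , cl , h) =
    _ , A , Card⇒ (A ∷ ρ) (suc i) v₀ h , classical-parts (classical⇒Cl cl)

  decomposition-shape : (ρ : Vec M n) (k t b m : Fin n) → T ρ (Decomposition k t b m) →
    Shape (lookup ρ t) (only 𝐭 P) → Shape (lookup ρ b) (only 𝐭 Q) → Shape (lookup ρ m) (only 𝐭 R) →
    Shape (lookup ρ k) (mix P Q R)
  decomposition-shape ρ k t b m (u , v , p , q , s , hu , hv , hp , hq , hs , hk) ht hb hm =
    sumOf-shape (s ∷ q ∷ p ∷ v ∷ u ∷ ρ) (5 ↑ʳ k) v₀ v₁ sum-𝐭𝐛-𝐧
      (sumOf-shape (s ∷ q ∷ p ∷ v ∷ u ∷ ρ) v₀ (5 ↑ʳ t) v₂ sum-𝐭-𝐛 ht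
        (productOf-shape (s ∷ q ∷ p ∷ v ∷ u ∷ ρ) v₂ (5 ↑ʳ b) v₄ 𝐛 hb (𝔟-shape (s ∷ q ∷ p ∷ v ∷ u ∷ ρ) v₄ (proj₂ empty) hu) hp) hs)
      (productOf-shape (s ∷ q ∷ p ∷ v ∷ u ∷ ρ) v₁ (5 ↑ʳ m) v₃ 𝐧 hm (𝔫-shape (s ∷ q ∷ p ∷ v ∷ u ∷ ρ) v₃ (proj₂ empty) hv) hq) hk

  -- Both decompositions give shapes of the same cardinal, so their parts agree up to bijection; a
  -- classical cardinal is determined by its 𝐭 part. Two environments occur because the
  -- decompositions sit at different binder depths.
  decomposition-unique : (ρ : Vec M m) (k t b c : Fin m) (σ : Vec M n) (k′ t′ b′ c′ : Fin n) →
    lookup ρ k ≡ lookup σ k′ →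
    T ρ (ClassicalDecomposition k t b c) → T σ (ClassicalDecomposition k′ t′ b′ c′) →
    lookup ρ t ≡ lookup σ t′ × lookup ρ b ≡ lookup σ b′ × lookup ρ c ≡ lookup σ c′
  decomposition-unique ρ k t b c σ k′ t′ b′ c′ k≡k′ (ct , cb , cc , d) (ct′ , cb′ , cc′ , d′) =
    let P , ht = classicalCardinal-shape ρ t ct ; P′ , ht′ = classicalCardinal-shape σ t′ ct′
        Q , hb = classicalCardinal-shape ρ b cb ; Q′ , hb′ = classicalCardinal-shape σ b′ cb′
        R , hc = classicalCardinal-shape ρ c cc ; R′ , hc′ = classicalCardinal-shape σ c′ cc′
        e = shape-≋ (subst (λ k → Shape k (mix P Q R)) k≡k′ (decomposition-shape ρ k t b c d ht hb hc))
                    (decomposition-shape σ k′ t′ b′ c′ d′ ht′ hb′ hc′)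
    in shape-unique ht ht′ (only-𝐭-≋ (e 𝐭)) ,
       shape-unique hb hb′ (only-𝐭-≋ (e 𝐛)) ,
       shape-unique hc hc′ (only-𝐭-≋ (e 𝐧))

  -- Existence of the decomposition

  PartCardinal : Status → M → Set ℓ
  PartCardinal κ A = ∃ λ k → ∃ λ X → IsClassical X × HasCard k X × HasParts X (only 𝐭 (part κ A))

  part-cardinal : ∀ κ A → HasSize (part κ A) → PartCardinal κ A
  part-cardinal κ A h =
    let X , hX = part-set κ A ; k , hk = HasCard-only 𝐭 (classical-parts hX) h
    in k , X , Cl⇒classical hX , hk , classical-parts hX

  sizes-exist : ∀ {k} → HasCard k A → ∀ κ → HasSize (part κ A)
  sizes-exist h κ = HasCard.size h κ , HasCard.card h κ

  parts-mix : ∀ {k} → HasCard k A → HasParts A (mix (part 𝐭 A) (part 𝐛 A) (part 𝐧 A))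
  parts-mix h 𝐭 = IsCard⇒≋ (HasCard.card h 𝐭) (HasCard.card h 𝐭)
  parts-mix h 𝐛 = IsCard⇒≋ (HasCard.card h 𝐛) (HasCard.card h 𝐛)
  parts-mix h 𝐧 = IsCard⇒≋ (HasCard.card h 𝐧) (HasCard.card h 𝐧)

  ProductCardinal : Status → M → M → M → Set ℓ
  ProductCardinal κ A Y B =
    ∃ λ p → ∃ λ V → IsProduct V Y B × HasCard p V × HasParts V (only κ (part κ A))

  product-cardinal : ∀ κ → HasSize (part κ A) → HasParts Y (only 𝐭 (part κ A)) →
    HasParts B (only κ (_≡ e)) → ProductCardinal κ A Y B
  product-cardinal {A = A} {Y} {B} {e} κ size hY hB = from-product (product-exists Y B)
    where
    from-product : (∃ λ V → IsProduct V Y B) → ProductCardinal κ A Y B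
    from-product (V , hV) =
      let V-parts = product-parts {V} κ hV hY hB ; p , hp = HasCard-only κ V-parts size
      in p , V , hV , hp , V-parts

  SumCardinal : M → M → M → Set ℓ
  SumCardinal A X V =
    ∃ λ s → ∃ λ S → IsSum S X V × HasCard s S × HasParts S (mix (part 𝐭 A) (part 𝐛 A) None)

  sum-cardinal : ∀ {k} → HasCard k A → HasParts X (only 𝐭 (part 𝐭 A)) →
    HasParts V (only 𝐛 (part 𝐛 A)) → SumCardinal A X V
  sum-cardinal {A = A} {X} {V} h hX hV = from-sum (sum-exists X V)
    where
    -- The truth side of the partial sum `S` is a copy of A^!, whose ordinal is part of the data of
    -- κ.
    size-bang : HasSize (λ x → part 𝐛 A x ⊎ part 𝐭 A x)
    size-bang = size-≋
      (≋-cong (⟺-sym ∘ bang⟺) (λ _ → ⟺-refl) (IsCard⇒≋ (HasCard.card! h) (HasCard.card! h)))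
      (_ , HasCard.card! h)
    from-sum : (∃ λ S → IsSum S X V) → SumCardinal A X V
    from-sum (S , hS) =
      let S-parts = sum-𝐭-𝐛 {S} hS hX hV
          s , hs = HasCard-mix S-parts (𝐛-𝐭-disjoint A) (λ _ _ ())
                     (sizes-exist h 𝐭) (sizes-exist h 𝐛) size-None
                     size-bang (size-∪-None (sizes-exist h 𝐭))
      in s , S , hS , hs , S-parts

  classicalCardinal : (ρ : Vec M n) (i : Fin n) → IsClassical X → HasCard (lookup ρ i) X →
    T ρ (ClassicalCardinal i)
  classicalCardinal {X = X} ρ i cl h = X , cl , ⇒Card (X ∷ ρ) (suc i) v₀ h

  decomposition : ∀ {u v p q s U W Z} (ρ : Vec M n) (k t b m : Fin n) →
    HasCard (lookup ρ t) X → HasCard (lookup ρ b) Y → HasCard (lookup ρ m) Z →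
    (∀ {n} (σ : Vec M n) i → HasCard (lookup σ i) B → T σ (Is𝔟 i)) → HasCard u B →
    (∀ {n} (σ : Vec M n) i → HasCard (lookup σ i) C → T σ (Is𝔫 i)) → HasCard v C →
    IsProduct V Y B → HasCard p V → IsProduct W Z C → HasCard q W →
    IsSum S X V → HasCard s S → IsSum U S W → HasCard (lookup ρ k) U →
    T ρ (Decomposition k t b m)
  decomposition {u = u} {v} {p} {q} {s} ρ k t b m hX hY hZ is-𝔟 hB is-𝔫 hC hV hp hW hq hS hs hU hk =
    u , v , p , q , s ,
    is-𝔟 (s ∷ q ∷ p ∷ v ∷ u ∷ ρ) v₄ hB ,
    is-𝔫 (s ∷ q ∷ p ∷ v ∷ u ∷ ρ) v₃ hC ,
    productOf (s ∷ q ∷ p ∷ v ∷ u ∷ ρ) v₂ (5 ↑ʳ b) v₄ hY hB hV hp ,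
    productOf (s ∷ q ∷ p ∷ v ∷ u ∷ ρ) v₁ (5 ↑ʳ m) v₃ hZ hC hW hq ,
    sumOf (s ∷ q ∷ p ∷ v ∷ u ∷ ρ) v₀ (5 ↑ʳ t) v₂ hX hp hS hs ,
    sumOf (s ∷ q ∷ p ∷ v ∷ u ∷ ρ) (5 ↑ʳ k) v₀ v₁ hs hq hU hk

  decomposition-exists : (ρ : Vec M n) (i : Fin n) → HasCard (lookup ρ i) A →
    ∃ λ t → ∃ λ b → ∃ λ m → T (m ∷ b ∷ t ∷ ρ) (ClassicalDecomposition (3 ↑ʳ i) v₂ v₁ v₀)
  decomposition-exists {n = n} {A} ρ i h =
    choose-parts (part-cardinal 𝐭 A (size 𝐭)) (part-cardinal 𝐛 A (size 𝐛)) (part-cardinal 𝐧 A (size 𝐧))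
      (𝔟-exists (proj₂ empty)) (𝔫-exists (proj₂ empty))
    where
    size = sizes-exist h
    Goal : Set ℓ
    Goal = ∃ λ t → ∃ λ b → ∃ λ m → T (m ∷ b ∷ t ∷ ρ) (ClassicalDecomposition (3 ↑ʳ i) v₂ v₁ v₀)
    choose-parts : PartCardinal 𝐭 A → PartCardinal 𝐛 A → PartCardinal 𝐧 A →
      Unit𝔟 → Unit𝔫 → Goal
    choose-parts (t , X , clX , hX , X-parts) (b , Y , clY , hY , Y-parts) (m , Z , clZ , hZ , Z-parts)
                 (e , u , B , hB , B-parts , is-𝔟) (e′ , v , C , hC , C-parts , is-𝔫) =
      choose-products (product-cardinal 𝐛 (size 𝐛) Y-parts B-parts)
                      (product-cardinal 𝐧 (size 𝐧) Z-parts C-parts)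
      where
      choose-products : ProductCardinal 𝐛 A Y B → ProductCardinal 𝐧 A Z C → Goal
      choose-products (p , V , hV , hp , V-parts) (q , W , hW , hq , W-parts) =
        choose-sums (sum-cardinal h X-parts V-parts)
        where
        choose-sums : SumCardinal A X V → Goal
        choose-sums (s , S , hS , hs , S-parts) = choose-total (sum-exists S W)
          where
          choose-total : (∃ λ U → IsSum U S W) → Goal
          choose-total (U , hU) =
            t , b , m ,
            classicalCardinal (m ∷ b ∷ t ∷ ρ) v₂ clX hX ,
            classicalCardinal (m ∷ b ∷ t ∷ ρ) v₁ clY hY ,
            classicalCardinal (m ∷ b ∷ t ∷ ρ) v₀ clZ hZ ,
            decomposition {V = V} {S = S} {U = U} {W} (m ∷ b ∷ t ∷ ρ) (3 ↑ʳ i) v₂ v₁ v₀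
              hX hY hZ is-𝔟 hB is-𝔫 hC hV hp hW hq hS hs hU
              -- The total `U` has the same parts as `A` up to bijection, so it inherits the
              -- cardinal κ itself and no ordinal has to be found for it.
              (HasCard-≋ (λ κ → ≋-trans (parts-mix h κ) (≋-sym (sum-𝐭𝐛-𝐧 {U} hU S-parts W-parts κ))) h)

  unique-decomposition : (ρ : Vec M n) → T ρ UniqueDecompositionIn
  unique-decomposition ρ k (A , h) =
    extend (decomposition-exists (k ∷ ρ) v₀ (Card⇒ (A ∷ k ∷ ρ) v₁ v₀ h))
    where
    extend :
      (∃ λ t → ∃ λ b → ∃ λ m → T (m ∷ b ∷ t ∷ k ∷ ρ) (ClassicalDecomposition v₃ v₂ v₁ v₀)) →
      T (k ∷ ρ) (∃̇ ∃̇ ∃̇ (ClassicalDecomposition v₃ v₂ v₁ v₀ ∧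
        ∀̇ ∀̇ ∀̇ (ClassicalDecomposition v₆ v₂ v₁ v₀ ⟶ v₂ ≐ v₅ ∧ v₁ ≐ v₄ ∧ v₀ ≐ v₃)))
    extend (t , b , m , d) = t , b , m , d , λ t′ b′ m′ d′ →
      decomposition-unique (m′ ∷ b′ ∷ t′ ∷ m ∷ b ∷ t ∷ k ∷ ρ) v₆ v₂ v₁ v₀
        (m ∷ b ∷ t ∷ k ∷ ρ) v₃ v₂ v₁ v₀ refl d′ d

corollary5p10 : ∀ {ℓ} → ExcludedMiddle ℓ → BZFC ⊨[ ℓ ] UniqueDecomposition
corollary5p10 em 𝔐 ax =
  recast 𝔐 UniqueDecompositionIn≡ (SetTheory.unique-decomposition em 𝔐 ax {0} [])
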